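{- For every integer $n\geq 1$ the following two identities hold: \[ \sum_{i,j\geq0} (-1)^j q^{i^2 + 3ij + \frac{3j(3j+1)}{2}} {n-i-3j\brack i}_q {n-i-2j-1\brack j}_{q^3} = \sum_{j\geq0} q^{j(3j+1)}(q^2;q^3)_j{n\brack 3j+1}_q, \] and \[ \sum_{i,j\geq0} (-1)^j q^{i^2 + 3ij + \frac{3j(3j+1)}{2}} {n-i-3j\brack i}_q {n-i-2j-1\brack j}_{q^3} - q\sum_{i,j\geq0} (-1)^j q^{i(i+1) + 3ij + \frac{9j(j+1)}{2}} {n-i-3j-1\brack i}_q {n-i-2j-2\brack j}_{q^3}= \sum_{j\geq0} q^{j(3j-1)}(q;q^3)_j{n\brack 3j}_q. \]
   Context: For $n\in\mathbb{Z}_{\geq0}$, $(a;q)_n := \prod_{i=0}^{n-1}(1-aq^i)$. The $q$-binomial coefficient is defined by ${A+B\brack B}_q = \frac{(q;q)_{A+B}}{(q;q)_A(q;q)_B}$ if $A,B\geq 0$ are integers, and ${A+B\brack B}_q=0$ otherwise; that is, ${N\brack B}_q$ is zero unless $0\le B\le N$. The symbol ${N\brack B}_{q^3}$ denotes the same expression with $q$ replaced by $q^3$. The indices $i,j$ run over non-negative integers, and all sums are finite. -}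

module Defs where

open import Level using (0ℓ)
open import Algebra.Bundles.Raw using (RawRing)
import Algebra.Definitions.RawSemiring as RawSemiringDefs
open import Data.Fin.Base using (toℕ)
open import Data.Integer.Base as ℤ using (ℤ; +_; -[1+_]; 0ℤ; 1ℤ)
open import Data.Nat.Base as ℕ using (ℕ; zero; suc)
open import Relation.Binary.PropositionalEquality.Core using (_≡_)

-- q is an indeterminate, and all identities are read in ℤ⟦q⟧, which contains
-- ℤ[q] and every fraction whose denominator has constant term 1.  A series is
-- its sequence of coefficients, and equality is coefficientwise.
ℤ⟦q⟧ : RawRing 0ℓ 0ℓ
ℤ⟦q⟧ = record
  { Carrier = ℕ → ℤ
  ; _≈_     = λ f g → ∀ k → f k ≡ g k
  ; _+_     = λ f g k → f k ℤ.+ g k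
  ; _*_     = λ f g k → sum {suc k} (λ i → f (toℕ i) ℤ.* g (k ℕ.∸ toℕ i))
  ; -_      = λ f k → ℤ.- f k
  ; 0#      = λ _ → 0ℤ
  ; 1#      = λ { zero → 1ℤ ; (suc _) → 0ℤ }
  }
  where open RawSemiringDefs ℤ.+-*-rawSemiring using (sum)

-- The operators are renamed so that they can be used alongside those of ℕ and ℤ.
open RawRing ℤ⟦q⟧ public
  using (_≈_; 0#; 1#; rawSemiring)
  renaming (Carrier to Series; _+_ to _⊕_; _*_ to _·_; -_ to ⊝_)

open RawSemiringDefs rawSemiring public using (_^_; sum; product)

infixl 6 _⊖_
_⊖_ : Series → Series → Series
f ⊖ g = f ⊕ (⊝ g)

q : Series
q 1 = 1ℤ
q _ = 0ℤ

-- Both endpoints 0 and m are included.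
∑≤ : ℕ → (ℕ → Series) → Series
∑≤ m f = sum {suc m} (λ i → f (toℕ i))

infixr 5 ∑≤
syntax ∑≤ m (λ i → f) = ∑[ i ≤ m ] f

-- Multiplicative inverse of a series g with constant term 1 (the only case
-- used), as the geometric series Σₑ (1 - g)ᵉ: since 1 - g has no constant term,
-- the powers e > k do not contribute to the coefficient of qᵏ.
recip : Series → Series
recip g k = (∑[ e ≤ k ] (1# ⊖ g) ^ e) k

infixl 7 _÷_
_÷_ : Series → Series → Series
f ÷ g = f · recip g

-- poch a b n = (a; b)ₙ
poch : Series → Series → ℕ → Series
poch a b n = product {n} (λ i → 1# ⊖ a · b ^ toℕ i)

-- qbinomial⁺ b A B is [A+B over B] in base b.
qbinomial⁺ : Series → ℤ → ℤ → Series
qbinomial⁺ b (+ A) (+ B) = poch b b (A ℕ.+ B) ÷ (poch b b A · poch b b B)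
qbinomial⁺ b _     _     = 0#

-- qbinomial b N B is [N over B] in base b, for a base b without constant term;
-- it vanishes unless 0 ≤ B ≤ N.
qbinomial : Series → ℤ → ℤ → Series
qbinomial b N B = qbinomial⁺ b (N ℤ.- B) B

{-# OPTIONS --safe #-}
-- Put M = i + 3j and N = n - M.  The exponent of q in the left-hand summand is
-- i(i-1)/2 + M(M+1)/2, so by the q-binomial theorem the double sum is
--   A(x) = Σ_M x^M q^{M(M+1)/2} [z^M] (-z;q)_N / (-z³;q³)_N   at x = 1,
-- and the double sum subtracted in the second identity is A(q) for n - 1.  Since
-- (1 + z³)/(1 + z) = 1 - z + z², the quotient is ∏_{k<N} 1/(1 - q^k z + q^{2k} z²),
-- and comparing N with N - 1 yields the three-term recurrence
--   A_n + x² q^{2n-3} A_{n-2} = (1 + x q^{n-1}) A_{n-1}   for n ≥ 3.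
-- Both right-hand sides are Σ_k d_k [n over k] with d_{k+3} = q^{2k+2} (1 - q^{k+1}) d_k,
-- k running through one residue class modulo 3, and they satisfy the recurrence for
-- x = 1 because
--   [n+2 over k] - (1 + q^{n+1}) [n+1 over k] + q^{2n+1} [n over k]
--     = q^{n+1} (q^{1-k} [n over k-2] - q^k (1 - q^{k+1}) [n over k+1])
-- telescopes against d_k.  The sequence q A_{n-1}(q) satisfies it as well, and the
-- initial values agree.
module Submission where

open import Algebra.Bundles using (CommutativeRing)
open import Data.Fin.Base using (toℕ)
open import Data.Integer.Base as ℤ using (ℤ; +_; -[1+_]; 0ℤ; 1ℤ; _-_)
import Data.Integer.Properties as ℤ
import Data.Integer.Solver as ℤ
open import Data.Nat.Base as ℕ using (ℕ; zero; suc; _∸_; _≤_; _<_; z≤n; s≤s)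
import Data.Nat.DivMod as ℕ
import Data.Nat.Properties as ℕ
import Data.Nat.Solver as ℕ
open import Data.Product.Base using (_×_; _,_)
open import Data.Sum.Base using (inj₁; inj₂)
open import Function.Base using (_∘_)
open import Level using (Level; 0ℓ)
import Relation.Binary.PropositionalEquality as ≡
open ≡ using (_≡_; module ≡-Reasoning)

-- Gaussian binomial coefficients in a commutative ring

module GaussianBinomial {c ℓ : Level} (R : CommutativeRing c ℓ) where
  open CommutativeRing R
  open import Algebra.Properties.CommutativeSemiring.Exp commutativeSemiring
  open import Algebra.Properties.Group +-group using () renaming (∙-cancelʳ to +-cancelʳ)
  open import Algebra.Solver.Ring.NaturalCoefficients.Default commutativeSemiring
    using (solve; _:+_; _:*_; _:=_; con)
  open import Relation.Binary.Reasoning.Setoid setoid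

  ^-split : ∀ y {k n} → k ≤ n → y ^ k * y ^ (n ∸ k) ≈ y ^ n
  ^-split y {k} {n} k≤n =
    trans (sym (^-homo-* y k (n ∸ k))) (^-congʳ y (ℕ.m+[n∸m]≡n k≤n))

  gauss : Carrier → ℕ → ℕ → Carrier
  gauss y n       zero    = 1#
  gauss y zero    (suc k) = 0#
  gauss y (suc n) (suc k) = gauss y n k + y ^ suc k * gauss y n (suc k)

  module _ (y : Carrier) where
    gauss-zero : ∀ {n k} → n < k → gauss y n k ≈ 0#
    gauss-zero {zero}  {suc k} _ = refl
    gauss-zero {suc n} {suc k} (s≤s n<k) = begin
      gauss y n k + y ^ suc k * gauss y n (suc k)  ≈⟨ +-cong (gauss-zero n<k) (*-congˡ (gauss-zero (ℕ.m<n⇒m<1+n n<k))) ⟩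
      0# + y ^ suc k * 0#                          ≈⟨ trans (+-identityˡ _) (zeroʳ _) ⟩
      0#                                           ∎

    gauss-diagonal : ∀ n → gauss y n n ≈ 1#
    gauss-diagonal zero    = refl
    gauss-diagonal (suc n) = begin
      gauss y n n + y ^ suc n * gauss y n (suc n)  ≈⟨ +-cong (gauss-diagonal n) (*-congˡ (gauss-zero (ℕ.n<1+n n))) ⟩
      1# + y ^ suc n * 0#                          ≈⟨ trans (+-congˡ (zeroʳ _)) (+-identityʳ _) ⟩
      1#                                           ∎

    -- For k > n truncated subtraction breaks y^k y^(n∸k) = y^n, but the coefficient then vanishes
    -- and takes both sides with it.
    gauss-^-split : ∀ n k → y ^ k * (y ^ (n ∸ k) * gauss y n k) ≈ y ^ n * gauss y n k
    gauss-^-split n k with ℕ.≤-<-connex k n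
    ... | inj₁ k≤n = trans (sym (*-assoc _ _ _)) (*-congʳ (^-split y k≤n))
    ... | inj₂ n<k = begin
      y ^ k * (y ^ (n ∸ k) * gauss y n k)  ≈⟨ *-congˡ (*-congˡ (gauss-zero n<k)) ⟩
      y ^ k * (y ^ (n ∸ k) * 0#)           ≈⟨ solve 3 (λ a b c → a :* (b :* con 0) := c :* con 0) refl _ _ _ ⟩
      y ^ n * 0#                           ≈⟨ *-congˡ (gauss-zero n<k) ⟨
      y ^ n * gauss y n k                  ∎

    gauss-^-split′ : ∀ n k → y ^ k * (y ^ (n ∸ k) * gauss y n (suc k)) ≈ y ^ n * gauss y n (suc k)
    gauss-^-split′ n k with ℕ.≤-<-connex k n
    ... | inj₁ k≤n = trans (sym (*-assoc _ _ _)) (*-congʳ (^-split y k≤n))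
    ... | inj₂ n<k = begin
      y ^ k * (y ^ (n ∸ k) * gauss y n (suc k))  ≈⟨ *-congˡ (*-congˡ z) ⟩
      y ^ k * (y ^ (n ∸ k) * 0#)                 ≈⟨ solve 3 (λ a b c → a :* (b :* con 0) := c :* con 0) refl _ _ _ ⟩
      y ^ n * 0#                                 ≈⟨ *-congˡ z ⟨
      y ^ n * gauss y n (suc k)                  ∎
      where z = gauss-zero (ℕ.m<n⇒m<1+n n<k)

    -- The dual q-Pascal rule. Induction on n: the hypothesis expands both coefficients of the
    -- defining rule, and the result regroups by the same rule one row lower.
    gauss-pascal : ∀ n k → gauss y (suc n) (suc k) ≈ y ^ (n ∸ k) * gauss y n k + gauss y n (suc k)
    gauss-pascal zero zero    = solve 1 (λ a → con 1 :+ (a :* con 1) :* con 0 := con 1 :* con 1 :+ con 0) refl y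
    gauss-pascal zero (suc k) = solve 2 (λ a b → con 0 :+ (a :* b) :* con 0 := con 1 :* con 0 :+ con 0) refl y (y ^ suc k)
    gauss-pascal (suc n) zero = begin
      1# + y * 1# * gauss y (suc n) 1             ≈⟨ +-congˡ (*-congˡ (gauss-pascal n 0)) ⟩
      1# + y * 1# * (y ^ n * 1# + gauss y n 1)
        ≈⟨ solve 3 (λ a b g → con 1 :+ (a :* con 1) :* (b :* con 1 :+ g) := a :* b :* con 1 :+ (con 1 :+ (a :* con 1) :* g)) refl y (y ^ n) (gauss y n 1) ⟩
      y * y ^ n * 1# + (1# + y * 1# * gauss y n 1) ∎
    gauss-pascal (suc n) (suc k) = begin
      gauss y (suc n) (suc k) + y * y ^ suc k * gauss y (suc n) (suc (suc k))
        ≈⟨ +-cong (gauss-pascal n k) (*-congˡ (gauss-pascal n (suc k))) ⟩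
      (u * g₀ + g₁) + y * (y * p) * (v * g₁ + g₂)
        ≈⟨ solve 7 (λ y p u v g₀ g₁ g₂ → (u :* g₀ :+ g₁) :+ y :* (y :* p) :* (v :* g₁ :+ g₂)
             := (u :* g₀ :+ g₁ :+ y :* (y :* p) :* g₂) :+ y :* ((y :* p) :* (v :* g₁))) refl y p u v g₀ g₁ g₂ ⟩
      (u * g₀ + g₁ + y * (y * p) * g₂) + y * ((y * p) * (v * g₁))
        -- Both products equal y^n `g₁`; the second form exhibits the factor `u` that is taken out
        -- next.
        ≈⟨ +-congˡ (*-congˡ (trans (gauss-^-split n (suc k)) (sym (gauss-^-split′ n k)))) ⟩
      (u * g₀ + g₁ + y * (y * p) * g₂) + y * (p * (u * g₁))
        ≈⟨ solve 6 (λ y p u g₀ g₁ g₂ → (u :* g₀ :+ g₁ :+ y :* (y :* p) :* g₂) :+ y :* (p :* (u :* g₁))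
             := u :* (g₀ :+ y :* p :* g₁) :+ (g₁ :+ y :* (y :* p) :* g₂)) refl y p u g₀ g₁ g₂ ⟩
      u * (g₀ + y * p * g₁) + (g₁ + y * (y * p) * g₂) ∎
      where
      p u v g₀ g₁ g₂ : Carrier
      p = y ^ k
      u = y ^ (n ∸ k)
      v = y ^ (n ∸ suc k)
      g₀ = gauss y n k
      g₁ = gauss y n (suc k)
      g₂ = gauss y n (suc (suc k))

    -- Equating the two Pascal expansions of [n+1 over k+1] gives (1 - y^(k+1)) [n over k+1] = (1 -
    -- y^(n-k)) [n over k]; the common factor y^k turns y^(n-k) into y^n.
    gauss-absorb : ∀ n k {s} → s + y ^ suc k ≈ 1# →
      y ^ k * s * gauss y n (suc k) + y ^ n * gauss y n k ≈ y ^ k * gauss y n k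
    gauss-absorb n k {s} s+yᵏ⁺¹≈1 = begin
      p * s * g₁ + y ^ n * g₀    ≈⟨ +-congˡ (gauss-^-split n k) ⟨
      p * s * g₁ + p * (u * g₀)  ≈⟨ solve 5 (λ p s u g₀ g₁ → p :* s :* g₁ :+ p :* (u :* g₀) := p :* (s :* g₁ :+ u :* g₀)) refl p s u g₀ g₁ ⟩
      p * (s * g₁ + u * g₀)      ≈⟨ *-congˡ (+-cancelʳ (r * g₁) _ _ (begin
          s * g₁ + u * g₀ + r * g₁    ≈⟨ solve 5 (λ r s u g₀ g₁ → s :* g₁ :+ u :* g₀ :+ r :* g₁ := u :* g₀ :+ (s :+ r) :* g₁) refl r s u g₀ g₁ ⟩
          u * g₀ + (s + r) * g₁       ≈⟨ +-congˡ (trans (*-congʳ s+yᵏ⁺¹≈1) (*-identityˡ g₁)) ⟩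
          u * g₀ + g₁                 ≈⟨ gauss-pascal n k ⟨
          g₀ + r * g₁                 ∎)) ⟩
      p * g₀                     ∎
      where
      p r u g₀ g₁ : Carrier
      p = y ^ k
      r = y ^ suc k
      u = y ^ (n ∸ k)
      g₀ = gauss y n k
      g₁ = gauss y n (suc k)

    -- yⁿ⁺²⁻ᵏ [n over k - 2], which is what one step of the telescoping moves from k to k + 3.
    lowered : ℕ → ℕ → Carrier
    lowered n (suc (suc k)) = y ^ (n ∸ k) * gauss y n k
    lowered n _             = 0#

    -- s stands for 1 - yᵏ⁺¹: the identity is kept free of subtraction so that the
    -- semiring solver applies.
    gauss-recurrence : ∀ n k {s} → s + y ^ suc k ≈ 1# →
      gauss y (2 ℕ.+ n) k + y * (y ^ n * y ^ n) * gauss y n k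
        + y * y ^ n * (y ^ k * s * gauss y n (suc k))
      ≈ (1# + y * y ^ n) * gauss y (suc n) k + lowered n k
    gauss-recurrence n zero {s} h = begin
      1# + y * (Q * Q) * 1# + y * Q * X
        ≈⟨ solve 3 (λ y Q X → con 1 :+ y :* (Q :* Q) :* con 1 :+ y :* Q :* X := con 1 :+ y :* Q :* (X :+ Q :* con 1)) refl y Q X ⟩
      1# + y * Q * (X + Q * 1#)
        ≈⟨ +-congˡ (*-congˡ (gauss-absorb n 0 h)) ⟩
      1# + y * Q * (1# * 1#)
        ≈⟨ solve 2 (λ y Q → con 1 :+ y :* Q :* (con 1 :* con 1) := (con 1 :+ y :* Q) :* con 1 :+ con 0) refl y Q ⟩
      (1# + y * Q) * 1# + 0# ∎
      where
      Q X : Carrier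
      Q = y ^ n
      X = y ^ 0 * s * gauss y n 1
    gauss-recurrence n (suc zero) {s} h = begin
      1# + y * 1# * (1# + y * 1# * g₁) + y * (Q * Q) * g₁ + y * Q * X
        ≈⟨ solve 4 (λ y Q g₁ X → con 1 :+ y :* con 1 :* (con 1 :+ y :* con 1 :* g₁) :+ y :* (Q :* Q) :* g₁ :+ y :* Q :* X
             := con 1 :+ y :* (con 1 :+ y :* con 1 :* g₁) :+ y :* Q :* (X :+ Q :* g₁)) refl y Q g₁ X ⟩
      1# + y * (1# + y * 1# * g₁) + y * Q * (X + Q * g₁)
        ≈⟨ +-cong (+-congˡ (*-congˡ (gauss-pascal n 0))) (*-congˡ (gauss-absorb n 1 h)) ⟩
      1# + y * (Q * 1# + g₁) + y * Q * (y * 1# * g₁)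
        ≈⟨ solve 3 (λ y Q g₁ → con 1 :+ y :* (Q :* con 1 :+ g₁) :+ y :* Q :* (y :* con 1 :* g₁)
             := (con 1 :+ y :* Q) :* (con 1 :+ y :* con 1 :* g₁) :+ con 0) refl y Q g₁ ⟩
      (1# + y * Q) * (1# + y * 1# * g₁) + 0# ∎
      where
      Q X g₁ : Carrier
      Q = y ^ n
      g₁ = gauss y n 1
      X = y ^ 1 * s * gauss y n 2
    gauss-recurrence n (suc (suc k)) {s} h = begin
      (g₀ + y * p * g₁) + y * (y * p) * (g₁ + y * (y * p) * g₂) + y * (Q * Q) * g₂ + y * Q * X
        ≈⟨ solve 7 (λ y p Q X g₀ g₁ g₂ →
             (g₀ :+ y :* p :* g₁) :+ y :* (y :* p) :* (g₁ :+ y :* (y :* p) :* g₂) :+ y :* (Q :* Q) :* g₂ :+ y :* Q :* X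
             := (g₀ :+ y :* p :* g₁) :+ y :* (y :* p) :* (g₁ :+ y :* (y :* p) :* g₂) :+ y :* Q :* (X :+ Q :* g₂))
             refl y p Q X g₀ g₁ g₂ ⟩
      (g₀ + y * p * g₁) + y * (y * p) * (g₁ + y * (y * p) * g₂) + y * Q * (X + Q * g₂)
        -- `gauss-absorb` eliminates the coefficient of lower index k + 3 contained in `X`, and the
        -- dual Pascal rule brings out `u * g₀`, which is `lowered` here.
        ≈⟨ +-cong (+-cong (gauss-pascal n k) (*-congˡ (gauss-pascal n (suc k)))) (*-congˡ (gauss-absorb n (2 ℕ.+ k) h)) ⟩
      (u * g₀ + g₁) + y * (y * p) * (v * g₁ + g₂) + y * Q * (y * (y * p) * g₂)
        ≈⟨ solve 8 (λ y p Q u v g₀ g₁ g₂ →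
             (u :* g₀ :+ g₁) :+ y :* (y :* p) :* (v :* g₁ :+ g₂) :+ y :* Q :* (y :* (y :* p) :* g₂)
             := y :* (y :* p :* (v :* g₁)) :+ ((u :* g₀ :+ g₁) :+ y :* (y :* p) :* g₂ :+ y :* Q :* (y :* (y :* p) :* g₂)))
             refl y p Q u v g₀ g₁ g₂ ⟩
      y * (y * p * (v * g₁)) + (u * g₀ + g₁ + y * (y * p) * g₂ + y * Q * (y * (y * p) * g₂))
        ≈⟨ +-congʳ (*-congˡ (gauss-^-split n (suc k))) ⟩
      y * (Q * g₁) + (u * g₀ + g₁ + y * (y * p) * g₂ + y * Q * (y * (y * p) * g₂))
        ≈⟨ solve 7 (λ y p Q u g₀ g₁ g₂ →
             y :* (Q :* g₁) :+ ((u :* g₀ :+ g₁) :+ y :* (y :* p) :* g₂ :+ y :* Q :* (y :* (y :* p) :* g₂))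
             := (con 1 :+ y :* Q) :* (g₁ :+ y :* (y :* p) :* g₂) :+ u :* g₀)
             refl y p Q u g₀ g₁ g₂ ⟩
      (1# + y * Q) * (g₁ + y * (y * p) * g₂) + u * g₀ ∎
      where
      p Q u v X g₀ g₁ g₂ : Carrier
      p = y ^ k
      Q = y ^ n
      u = y ^ (n ∸ k)
      v = y ^ (n ∸ suc k)
      X = y ^ suc (suc k) * s * gauss y n (suc (suc (suc k)))
      g₀ = gauss y n k
      g₁ = gauss y n (suc k)
      g₂ = gauss y n (suc (suc k))

-- Finite sums and the finite geometric series

module FiniteSums {c ℓ : Level} (R : CommutativeRing c ℓ) where
  open CommutativeRing R
  open import Algebra.Properties.Semiring.Sum semiring
    using (sum; sum-cong-≋; sum-replicate-zero; ∑-distrib-+; *-distribˡ-sum)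
  open import Algebra.Properties.Semiring.Exp semiring using (_^_)
  open import Algebra.Solver.Ring.NaturalCoefficients.Default commutativeSemiring
    using (solve; _:+_; _:*_; _:=_; con)
  open import Relation.Binary.Reasoning.Setoid setoid

  ∑< : ℕ → (ℕ → Carrier) → Carrier
  ∑< n f = sum {n} (f ∘ toℕ)

  ∑<-cong : ∀ n {f g : ℕ → Carrier} → (∀ i → f i ≈ g i) → ∑< n f ≈ ∑< n g
  ∑<-cong n f≈g = sum-cong-≋ {n} (f≈g ∘ toℕ)

  ∑<-zero : ∀ n {f : ℕ → Carrier} → (∀ i → f i ≈ 0#) → ∑< n f ≈ 0#
  ∑<-zero n f≈0 = trans (∑<-cong n f≈0) (sum-replicate-zero n)

  ∑<-+ : ∀ n (f g : ℕ → Carrier) → ∑< n (λ i → f i + g i) ≈ ∑< n f + ∑< n g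
  ∑<-+ n f g = ∑-distrib-+ {n} (f ∘ toℕ) (g ∘ toℕ)

  ∑<-*ˡ : ∀ n x (f : ℕ → Carrier) → ∑< n (λ i → x * f i) ≈ x * ∑< n f
  ∑<-*ˡ n x f = sym (*-distribˡ-sum {n} x (f ∘ toℕ))

  ∑<-head : ∀ n (f : ℕ → Carrier) → (∀ i → f (suc i) ≈ 0#) → ∑< (suc n) f ≈ f 0
  ∑<-head n f tail≈0 = trans (+-congˡ (∑<-zero n tail≈0)) (+-identityʳ _)

  ∑<-last : ∀ n (f : ℕ → Carrier) → ∑< (suc n) f ≈ ∑< n f + f n
  ∑<-last zero    f = +-comm _ _
  ∑<-last (suc n) f = trans (+-congˡ (∑<-last n (f ∘ suc))) (sym (+-assoc _ _ _))

  -- Sums a Pascal-type splitting over a fixed range. The part `p`, coming from the preceding index,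
  -- fills only the indices below m; `p m ≈ 0` restores the full range, so that all sums can keep
  -- one common bound.
  ∑<-shift : ∀ m (a s p : ℕ → Carrier) → a 0 ≈ s 0 → (∀ i → a (suc i) ≈ s (suc i) + p i) → p m ≈ 0# →
    ∑< (suc m) a ≈ ∑< (suc m) s + ∑< (suc m) p
  ∑<-shift m a s p a₀≈s₀ aᵢ≈sᵢ+pᵢ pₘ≈0 = begin
    a 0 + ∑< m (a ∘ suc)                   ≈⟨ +-cong a₀≈s₀ (trans (∑<-cong m aᵢ≈sᵢ+pᵢ) (∑<-+ m (s ∘ suc) p)) ⟩
    s 0 + (∑< m (s ∘ suc) + ∑< m p)        ≈⟨ +-assoc _ _ _ ⟨
    ∑< (suc m) s + ∑< m p                  ≈⟨ +-congˡ (trans (+-congˡ pₘ≈0) (+-identityʳ _)) ⟨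
    ∑< (suc m) s + (∑< m p + p m)          ≈⟨ +-congˡ (∑<-last m p) ⟨
    ∑< (suc m) s + ∑< (suc m) p            ∎

  -- The partial sums of 1/g with h = 1 - g and their remainder h^n; each step trades h^n for g h^n
  -- + h^(n+1).
  geometric : ∀ g h → g + h ≈ 1# → ∀ n → g * ∑< n (h ^_) + h ^ n ≈ 1#
  geometric g h g+h≈1 zero    = trans (+-congʳ (zeroʳ g)) (+-identityˡ 1#)
  geometric g h g+h≈1 (suc n) = begin
    g * ∑< (suc n) (h ^_) + h * h ^ n      ≈⟨ +-congʳ (*-congˡ (∑<-last n (h ^_))) ⟩
    g * (∑< n (h ^_) + h ^ n) + h * h ^ n
      ≈⟨ solve 4 (λ g h s p → g :* (s :+ p) :+ h :* p := g :* s :+ (g :+ h) :* p) refl g h (∑< n (h ^_)) (h ^ n) ⟩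
    g * ∑< n (h ^_) + (g + h) * h ^ n      ≈⟨ +-congˡ (trans (*-congʳ g+h≈1) (*-identityˡ _)) ⟩
    g * ∑< n (h ^_) + h ^ n                ≈⟨ geometric g h g+h≈1 n ⟩
    1#                                     ∎

-- Arithmetic of the exponents of q

module Exponents where
  open ℕ.+-*-Solver using (solve; _:+_; _:*_; _:=_; con)

  -- The increment is 2k + 2 for k = 3j + 1, the source of the factor q^(2k+2) in the recursion for
  -- d.
  j[3j+1]-suc : ∀ j → suc j ℕ.* (3 ℕ.* suc j ℕ.+ 1) ≡ suc (3 ℕ.* j ℕ.+ 1) ℕ.+ (suc (3 ℕ.* j ℕ.+ 1) ℕ.+ j ℕ.* (3 ℕ.* j ℕ.+ 1))
  j[3j+1]-suc = solve 1 (λ j → let k = con 1 :+ (con 3 :* j :+ con 1) in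
    (con 1 :+ j) :* (con 3 :* (con 1 :+ j) :+ con 1) := k :+ (k :+ j :* (con 3 :* j :+ con 1))) ≡.refl

  j[3j∸1]-suc : ∀ j → suc j ℕ.* (3 ℕ.* suc j ∸ 1) ≡ suc (3 ℕ.* j) ℕ.+ (suc (3 ℕ.* j) ℕ.+ j ℕ.* (3 ℕ.* j ∸ 1))
  j[3j∸1]-suc zero    = ≡.refl
  -- From j = 1 on, `3 * suc j ∸ 1` computes to `j + (suc j + (suc j + 0))`, the polynomial shape
  -- handed to the solver.
  j[3j∸1]-suc (suc j) = solve 1 (λ j →
    let s = con 1 :+ j; t = con 2 :+ j; k = con 1 :+ con 3 :* s in
    t :* (s :+ (t :+ (t :+ con 0))) := k :+ (k :+ s :* (j :+ (s :+ (s :+ con 0))))) ≡.refl j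

  i+3j+N : ∀ i j N → i ℕ.+ 3 ℕ.* j ℕ.+ N ≡ i ℕ.+ 2 ℕ.* j ℕ.+ (N ℕ.+ j)
  i+3j+N = solve 3 (λ i j N → i :+ con 3 :* j :+ N := i :+ con 2 :* j :+ (N :+ j)) ≡.refl

  -- tri n = n (n - 1) / 2
  tri : ℕ → ℕ
  tri zero    = 0
  tri (suc i) = i ℕ.+ tri i

  tri*2 : ∀ n → tri n ℕ.* 2 ℕ.+ n ≡ n ℕ.* n
  tri*2 zero    = ≡.refl
  tri*2 (suc n) = ≡.trans
    (solve 2 (λ n t → (n :+ t) :* con 2 :+ (con 1 :+ n) := (t :* con 2 :+ n) :+ (con 1 :+ con 2 :* n)) ≡.refl n (tri n))
    (≡.trans (≡.cong (ℕ._+ (1 ℕ.+ 2 ℕ.* n)) (tri*2 n))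
      (solve 1 (λ n → n :* n :+ (con 1 :+ con 2 :* n) := (con 1 :+ n) :* (con 1 :+ n)) ≡.refl n))

  tri-suc*2 : ∀ n → tri (suc n) ℕ.* 2 ≡ n ℕ.* (n ℕ.+ 1)
  tri-suc*2 n = ≡.trans
    (solve 2 (λ n t → (n :+ t) :* con 2 := (t :* con 2 :+ n) :+ n) ≡.refl n (tri n))
    (≡.trans (≡.cong (ℕ._+ n) (tri*2 n)) (solve 1 (λ n → n :* n :+ n := n :* (n :+ con 1)) ≡.refl n))

  tri-+ : ∀ a b → tri (suc (a ℕ.+ b)) ≡ tri (suc a) ℕ.+ tri (suc b) ℕ.+ a ℕ.* b
  tri-+ zero    b = ≡.sym (ℕ.+-identityʳ _)
  tri-+ (suc a) b = ≡.trans (≡.cong (suc (a ℕ.+ b) ℕ.+_) (tri-+ a b))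
    (solve 4 (λ a b s t → con 1 :+ (a :+ b) :+ (s :+ t :+ a :* b) := con 1 :+ a :+ s :+ t :+ (b :+ a :* b)) ≡.refl
      a b (tri (suc a)) (tri (suc b)))

  half : ∀ n m → n ≡ m ℕ.* 2 → n ℕ./ 2 ≡ m
  half n m n≡m*2 = ≡.trans (≡.cong (ℕ._/ 2) n≡m*2) (ℕ.m*n/n≡m m 2)

  -- The division is exact: 3j(3j+1)/2 is the triangular number of 3j. With i² = 2 `tri i` + i, the
  -- cross term 3ij completes the triangular number of M = i + 3j, leaving the i(i-1)/2 of the
  -- q-binomial theorem.
  first-exponent : ∀ i j → i ℕ.* i ℕ.+ 3 ℕ.* i ℕ.* j ℕ.+ 3 ℕ.* j ℕ.* (3 ℕ.* j ℕ.+ 1) ℕ./ 2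
                         ≡ tri (suc (i ℕ.+ 3 ℕ.* j)) ℕ.+ tri i
  first-exponent i j = begin
    i ℕ.* i ℕ.+ 3 ℕ.* i ℕ.* j ℕ.+ 3 ℕ.* j ℕ.* (3 ℕ.* j ℕ.+ 1) ℕ./ 2
      ≡⟨ ≡.cong₂ (λ a b → a ℕ.+ 3 ℕ.* i ℕ.* j ℕ.+ b) (≡.sym (tri*2 i))
           (half _ (tri (suc (3 ℕ.* j))) (≡.sym (tri-suc*2 (3 ℕ.* j)))) ⟩
    tri i ℕ.* 2 ℕ.+ i ℕ.+ 3 ℕ.* i ℕ.* j ℕ.+ tri (suc (3 ℕ.* j))
      ≡⟨ solve 4 (λ i j t T → t :* con 2 :+ i :+ con 3 :* i :* j :+ T := i :+ t :+ T :+ i :* (con 3 :* j) :+ t) ≡.refl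
           i j (tri i) (tri (suc (3 ℕ.* j))) ⟩
    tri (suc i) ℕ.+ tri (suc (3 ℕ.* j)) ℕ.+ i ℕ.* (3 ℕ.* j) ℕ.+ tri i
      ≡⟨ ≡.cong (ℕ._+ tri i) (tri-+ i (3 ℕ.* j)) ⟨
    tri (suc (i ℕ.+ 3 ℕ.* j)) ℕ.+ tri i ∎
    where open ≡.≡-Reasoning

  -- Here 9j(j+1)/2 exceeds the triangular number of 3j by 3j, and i(i+1) exceeds i² by i. The total
  -- excess M = i + 3j accounts for x^M at x = q.
  second-exponent : ∀ i j → i ℕ.* (i ℕ.+ 1) ℕ.+ 3 ℕ.* i ℕ.* j ℕ.+ 9 ℕ.* j ℕ.* (j ℕ.+ 1) ℕ./ 2
                          ≡ i ℕ.+ 3 ℕ.* j ℕ.+ tri (suc (i ℕ.+ 3 ℕ.* j)) ℕ.+ tri i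
  second-exponent i j = begin
    i ℕ.* (i ℕ.+ 1) ℕ.+ 3 ℕ.* i ℕ.* j ℕ.+ 9 ℕ.* j ℕ.* (j ℕ.+ 1) ℕ./ 2
      ≡⟨ ≡.cong₂ (λ a b → a ℕ.+ 3 ℕ.* i ℕ.* j ℕ.+ b) (≡.sym (tri-suc*2 i)) (half _ (3 ℕ.* j ℕ.+ T) (≡.sym (begin
        (3 ℕ.* j ℕ.+ T) ℕ.* 2                           ≡⟨ ℕ.*-distribʳ-+ 2 (3 ℕ.* j) T ⟩
        3 ℕ.* j ℕ.* 2 ℕ.+ T ℕ.* 2                       ≡⟨ ≡.cong (3 ℕ.* j ℕ.* 2 ℕ.+_) (tri-suc*2 (3 ℕ.* j)) ⟩
        3 ℕ.* j ℕ.* 2 ℕ.+ 3 ℕ.* j ℕ.* (3 ℕ.* j ℕ.+ 1)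
          ≡⟨ solve 1 (λ j → con 3 :* j :* con 2 :+ con 3 :* j :* (con 3 :* j :+ con 1) := con 9 :* j :* (j :+ con 1)) ≡.refl j ⟩
        9 ℕ.* j ℕ.* (j ℕ.+ 1)                           ∎))) ⟩
    tri (suc i) ℕ.* 2 ℕ.+ 3 ℕ.* i ℕ.* j ℕ.+ (3 ℕ.* j ℕ.+ T)
      ≡⟨ solve 4 (λ i j t T → (i :+ t) :* con 2 :+ con 3 :* i :* j :+ (con 3 :* j :+ T)
           := i :+ con 3 :* j :+ (i :+ t :+ T :+ i :* (con 3 :* j)) :+ t) ≡.refl i j (tri i) T ⟩
    i ℕ.+ 3 ℕ.* j ℕ.+ (tri (suc i) ℕ.+ T ℕ.+ i ℕ.* (3 ℕ.* j)) ℕ.+ tri i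
      ≡⟨ ≡.cong (λ a → i ℕ.+ 3 ℕ.* j ℕ.+ a ℕ.+ tri i) (tri-+ i (3 ℕ.* j)) ⟨
    i ℕ.+ 3 ℕ.* j ℕ.+ tri (suc (i ℕ.+ 3 ℕ.* j)) ℕ.+ tri i ∎
    where
    open ≡.≡-Reasoning
    T : ℕ
    T = tri (suc (3 ℕ.* j))

-- Recurrences for the two sides of the identities

module Recurrences {c ℓ : Level} (R : CommutativeRing c ℓ) (q : CommutativeRing.Carrier R) where
  open CommutativeRing R
  open FiniteSums R
  open GaussianBinomial R
  open Exponents
  open import Algebra.Properties.CommutativeSemiring.Exp commutativeSemiring
  open import Algebra.Properties.Group +-group using () renaming (∙-cancelʳ to +-cancelʳ)
  open import Algebra.Solver.Ring.NaturalCoefficients.Default commutativeSemiring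
    using (solve; _:+_; _:*_; _:=_; con)
  open import Relation.Binary.Reasoning.Setoid setoid

  -- Binomial sums with lower indices in one residue class modulo 3

  module BinomialSum
    (κ : ℕ → ℕ) (κ₀≤1 : κ 0 ≤ 1) (κ-suc : ∀ j → κ (suc j) ≡ 3 ℕ.+ κ j)
    (d t : ℕ → Carrier) (t+q^ : ∀ j → t j + q ^ suc (κ j) ≈ 1#)
    (d-suc : ∀ j → d (suc j) ≈ q ^ suc (κ j) * (q ^ suc (κ j) * t j) * d j)
    (m : ℕ)
    where

    j≤κ : ∀ j → j ≤ κ j
    j≤κ zero    = z≤n
    j≤κ (suc j) rewrite κ-suc j = s≤s (ℕ.m≤n⇒m≤o+n 2 (j≤κ j))

    S : ℕ → Carrier
    S n = ∑< (suc m) (λ j → d j * gauss q n (κ j))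

    -- Termwise this is `gauss-recurrence`, with an excess `X j` on the left and `L j` on the right.
    -- The recursion for `d` makes `L (suc j)` equal to `X j`, so the two excesses have the same sum
    -- and cancel. At the ends, `L 0` vanishes because κ 0 ≤ 1, and `X m` because n ≤ m ≤ κ m.
    S-recurrence : ∀ n → n ≤ m →
      S (2 ℕ.+ n) + q * (q ^ n * q ^ n) * S n ≈ (1# + q * q ^ n) * S (1 ℕ.+ n)
    S-recurrence n n≤m = +-cancelʳ (∑< (suc m) X) _ _ (begin
      S (2 ℕ.+ n) + b * S n + ∑< (suc m) X
        ≈⟨ +-congʳ (+-congˡ (∑<-*ˡ (suc m) b (D n))) ⟨
      S (2 ℕ.+ n) + ∑< (suc m) (λ j → b * D n j) + ∑< (suc m) X
        ≈⟨ +-congʳ (∑<-+ (suc m) (D (2 ℕ.+ n)) (λ j → b * D n j)) ⟨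
      ∑< (suc m) (λ j → D (2 ℕ.+ n) j + b * D n j) + ∑< (suc m) X
        ≈⟨ ∑<-+ (suc m) (λ j → D (2 ℕ.+ n) j + b * D n j) X ⟨
      ∑< (suc m) (λ j → D (2 ℕ.+ n) j + b * D n j + X j)
        ≈⟨ ∑<-cong (suc m) term ⟩
      ∑< (suc m) (λ j → a * D (1 ℕ.+ n) j + L j)
        ≈⟨ ∑<-+ (suc m) (λ j → a * D (1 ℕ.+ n) j) L ⟩
      ∑< (suc m) (λ j → a * D (1 ℕ.+ n) j) + ∑< (suc m) L
        ≈⟨ +-cong (∑<-*ˡ (suc m) a (D (1 ℕ.+ n))) L≈X ⟩
      a * S (1 ℕ.+ n) + ∑< (suc m) X ∎)
      where
      a b : Carrier
      a = 1# + q * q ^ n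
      b = q * (q ^ n * q ^ n)
      D : ℕ → ℕ → Carrier
      D n j = d j * gauss q n (κ j)
      L X : ℕ → Carrier
      L j = d j * lowered q n (κ j)
      X j = d j * (q * q ^ n * (q ^ κ j * t j * gauss q n (suc (κ j))))

      term : ∀ j → D (2 ℕ.+ n) j + b * D n j + X j ≈ a * D (1 ℕ.+ n) j + L j
      term j = begin
        d j * g₂ + b * (d j * g₀) + d j * x
          ≈⟨ solve 5 (λ d b g₀ g₂ x → d :* g₂ :+ b :* (d :* g₀) :+ d :* x := d :* (g₂ :+ b :* g₀ :+ x)) refl (d j) b g₀ g₂ x ⟩
        d j * (g₂ + b * g₀ + x)
          ≈⟨ *-congˡ (gauss-recurrence q n (κ j) (t+q^ j)) ⟩
        d j * (a * g₁ + l)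
          ≈⟨ solve 4 (λ d a g₁ l → d :* (a :* g₁ :+ l) := a :* (d :* g₁) :+ d :* l) refl (d j) a g₁ l ⟩
        a * (d j * g₁) + d j * l ∎
        where
        g₀ g₁ g₂ x l : Carrier
        g₀ = gauss q n (κ j)
        g₁ = gauss q (1 ℕ.+ n) (κ j)
        g₂ = gauss q (2 ℕ.+ n) (κ j)
        x = q * q ^ n * (q ^ κ j * t j * gauss q n (suc (κ j)))
        l = lowered q n (κ j)

      lowered-κ₀ : ∀ k → k ≤ 1 → lowered q n k ≈ 0#
      lowered-κ₀ zero          _        = refl
      lowered-κ₀ (suc zero)    _        = refl
      lowered-κ₀ (suc (suc k)) (s≤s ())

      -- At κ + 3 the lowered term is q^(n∸(κ+1)) [n over κ+1]. Of the two factors q^(κ+1) in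
      -- `d-suc`, one completes this power to q^n and the other is the q · q^κ occurring in `X`.
      L-suc : ∀ j → L (suc j) ≈ X j
      L-suc j = begin
        d (suc j) * lowered q n (κ (suc j))
          ≈⟨ *-cong (d-suc j) (reflexive (≡.cong (lowered q n) (κ-suc j))) ⟩
        q * p * (q * p * t j) * d j * (q ^ (n ∸ suc (κ j)) * g)
          ≈⟨ solve 6 (λ q p t d u g → q :* p :* (q :* p :* t) :* d :* (u :* g)
               := d :* (q :* (p :* t)) :* (q :* p :* (u :* g))) refl q p (t j) (d j) (q ^ (n ∸ suc (κ j))) g ⟩
        d j * (q * (p * t j)) * (q ^ suc (κ j) * (q ^ (n ∸ suc (κ j)) * g))
          ≈⟨ *-congˡ (gauss-^-split q n (suc (κ j))) ⟩
        d j * (q * (p * t j)) * (q ^ n * g)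
          ≈⟨ solve 6 (λ q p t d Q g → d :* (q :* (p :* t)) :* (Q :* g) := d :* (q :* Q :* (p :* t :* g)))
               refl q p (t j) (d j) (q ^ n) g ⟩
        X j ∎
        where
        p g : Carrier
        p = q ^ κ j
        g = gauss q n (suc (κ j))

      X-last : X m ≈ 0#
      X-last = begin
        d m * (q * q ^ n * (q ^ κ m * t m * gauss q n (suc (κ m))))
          ≈⟨ *-congˡ (*-congˡ (*-congˡ (gauss-zero q (s≤s (ℕ.≤-trans n≤m (j≤κ m)))))) ⟩
        d m * (q * q ^ n * (q ^ κ m * t m * 0#))
          ≈⟨ solve 3 (λ a b c → a :* (b :* (c :* con 0)) := con 0) refl _ _ _ ⟩
        0# ∎

      L≈X : ∑< (suc m) L ≈ ∑< (suc m) X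
      L≈X = begin
        ∑< (suc m) L                          ≈⟨ ∑<-shift m L (λ _ → 0#) X (trans (*-congˡ (lowered-κ₀ (κ 0) κ₀≤1)) (zeroʳ _))
                                                   (λ j → trans (L-suc j) (sym (+-identityˡ _))) X-last ⟩
        ∑< (suc m) (λ _ → 0#) + ∑< (suc m) X  ≈⟨ +-congʳ (∑<-zero (suc m) (λ _ → refl)) ⟩
        0# + ∑< (suc m) X                     ≈⟨ +-identityˡ _ ⟩
        ∑< (suc m) X                          ∎

  -- delay s f n is f (n - s), and 0 when n < s.
  delay : ℕ → (ℕ → Carrier) → ℕ → Carrier
  delay zero    f n       = f n
  delay (suc s) f zero    = 0#
  delay (suc s) f (suc n) = delay s f n

  delay-cong : ∀ s {f g : ℕ → Carrier} n → (∀ N → s ℕ.+ N ≡ n → f N ≈ g N) → delay s f n ≈ delay s g n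
  delay-cong zero    n       f≈g = f≈g n ≡.refl
  delay-cong (suc s) zero    f≈g = refl
  delay-cong (suc s) (suc n) f≈g = delay-cong s n (λ N e → f≈g N (≡.cong suc e))

  delay-at : ∀ s (f : ℕ → Carrier) N → delay s f (s ℕ.+ N) ≈ f N
  delay-at zero    f N = refl
  delay-at (suc s) f N = delay-at s f N

  delay-+ : ∀ s (f g : ℕ → Carrier) n → delay s (λ N → f N + g N) n ≈ delay s f n + delay s g n
  delay-+ zero    f g n       = refl
  delay-+ (suc s) f g zero    = sym (+-identityˡ 0#)
  delay-+ (suc s) f g (suc n) = delay-+ s f g n

  delay-*ˡ : ∀ s x (f : ℕ → Carrier) n → delay s (λ N → x * f N) n ≈ x * delay s f n
  delay-*ˡ zero    x f n       = refl
  delay-*ˡ (suc s) x f zero    = sym (zeroʳ x)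
  delay-*ˡ (suc s) x f (suc n) = delay-*ˡ s x f n

  delay-zero : ∀ {s n} (f : ℕ → Carrier) → n < s → delay s f n ≈ 0#
  delay-zero {suc s} {zero}  f _         = refl
  delay-zero {suc s} {suc n} f (s≤s n<s) = delay-zero f n<s

  -- Only at s = n + 1 does the left side evaluate `f 0` while the right side takes the default 0;
  -- the premise covers exactly that case.
  delay-suc : ∀ s (f : ℕ → Carrier) n → (s ≡ suc n → f 0 ≈ 0#) → delay s f (suc n) ≈ delay s (f ∘ suc) n
  delay-suc zero          f n       f₀≈0 = refl
  delay-suc (suc zero)    f zero    f₀≈0 = f₀≈0 ≡.refl
  delay-suc (suc (suc s)) f zero    f₀≈0 = refl
  delay-suc (suc s)       f (suc n) f₀≈0 = delay-suc s f n (f₀≈0 ∘ ≡.cong suc)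

  -- u N i is the coefficient of zⁱ in (-z; q)_N.
  u : ℕ → ℕ → Carrier
  u N i = q ^ tri i * gauss q N i

  -- Coefficient form of (-z; q)_(N+1) = (1 + q^N z) (-z; q)_N. The q^i split off from
  -- q^`tri (suc i)` completes the q^(N-i) of the dual Pascal rule to q^N.
  u-suc : ∀ N i → u (suc N) (suc i) ≈ u N (suc i) + q ^ N * u N i
  u-suc N i = begin
    q ^ (i ℕ.+ tri i) * gauss q (suc N) (suc i)
      ≈⟨ *-cong (^-homo-* q i (tri i)) (gauss-pascal q N i) ⟩
    q ^ i * q ^ tri i * (q ^ (N ∸ i) * gauss q N i + gauss q N (suc i))
      ≈⟨ solve 5 (λ a b v g₀ g₁ → a :* b :* (v :* g₀ :+ g₁) := a :* b :* g₁ :+ b :* (a :* (v :* g₀))) refl _ _ _ _ _ ⟩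
    q ^ i * q ^ tri i * gauss q N (suc i) + q ^ tri i * (q ^ i * (q ^ (N ∸ i) * gauss q N i))
      ≈⟨ +-cong (*-congʳ (sym (^-homo-* q i (tri i)))) (*-congˡ (gauss-^-split q N i)) ⟩
    u N (suc i) + q ^ tri i * (q ^ N * gauss q N i)
      ≈⟨ +-congˡ (solve 3 (λ b Q g → b :* (Q :* g) := Q :* (b :* g)) refl _ _ _) ⟩
    u N (suc i) + q ^ N * u N i ∎

  -- v N j is the coefficient of z³ʲ in 1 / (-z³; q³)_N.
  v : ℕ → ℕ → Carrier
  v zero    zero    = 1#
  v zero    (suc j) = 0#
  v (suc N) j       = (- 1#) ^ j * gauss (q ^ 3) (N ℕ.+ j) j

  v-zero : ∀ N → v N 0 ≈ 1#
  v-zero zero    = refl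
  v-zero (suc N) = *-identityˡ 1#

  -- Coefficient form of 1/(-z³; q³)_N = (1 + q^(3N) z³) / (-z³; q³)_(N+1). For N = 0 the left side
  -- is 0 and the two terms on the right have opposite signs; for N > 0 it is the dual Pascal rule
  -- in base q³.
  v-suc : ∀ N j → v N (suc j) ≈ v (suc N) (suc j) + q ^ N * (q ^ N * q ^ N) * v (suc N) j
  v-suc N j = trans (lemma N) (+-congˡ (*-congʳ cube))
    where
    ε : Carrier
    ε = (- 1#) ^ j

    cube : (q ^ 3) ^ N ≈ q ^ N * (q ^ N * q ^ N)
    cube = begin
      (q ^ 3) ^ N                     ≈⟨ ^-assocʳ q 3 N ⟩
      q ^ (3 ℕ.* N)                   ≈⟨ ^-congʳ q (ℕ.*-comm 3 N) ⟩
      q ^ (N ℕ.* 3)                   ≈⟨ ^-assocʳ q N 3 ⟨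
      q ^ N * (q ^ N * (q ^ N * 1#))  ≈⟨ *-congˡ (*-congˡ (*-identityʳ _)) ⟩
      q ^ N * (q ^ N * q ^ N)         ∎

    cancel : ∀ a b → - 1# * ε * b ≈ - 1# * ε * (a + b) + a * ε
    cancel a b = sym (begin
      - 1# * ε * (a + b) + a * ε          ≈⟨ solve 4 (λ m e a b → m :* e :* (a :+ b) :+ a :* e := m :* e :* b :+ (m :+ con 1) :* (e :* a)) refl (- 1#) ε a b ⟩
      - 1# * ε * b + (- 1# + 1#) * (ε * a) ≈⟨ +-congˡ (trans (*-congʳ (-‿inverseˡ 1#)) (zeroˡ _)) ⟩
      - 1# * ε * b + 0#                   ≈⟨ +-identityʳ _ ⟩
      - 1# * ε * b                        ∎)

    lemma : ∀ N → v N (suc j) ≈ v (suc N) (suc j) + (q ^ 3) ^ N * v (suc N) j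
    lemma zero = sym (begin
      - 1# * ε * gauss (q ^ 3) (suc j) (suc j) + 1# * (ε * gauss (q ^ 3) j j)
        ≈⟨ +-cong (*-congˡ (gauss-diagonal (q ^ 3) (suc j))) (*-congˡ (*-congˡ (gauss-diagonal (q ^ 3) j))) ⟩
      - 1# * ε * 1# + 1# * (ε * 1#)
        ≈⟨ solve 2 (λ m e → m :* e :* con 1 :+ con 1 :* (e :* con 1) := (m :+ con 1) :* e) refl (- 1#) ε ⟩
      (- 1# + 1#) * ε
        ≈⟨ trans (*-congʳ (-‿inverseˡ 1#)) (zeroˡ _) ⟩
      0# ∎)
    lemma (suc N) = begin
      - 1# * ε * gauss z (N ℕ.+ suc j) (suc j)
        ≈⟨ cancel (z ^ suc N * g) (gauss z (N ℕ.+ suc j) (suc j)) ⟩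
      - 1# * ε * (z ^ suc N * g + gauss z (N ℕ.+ suc j) (suc j)) + z ^ suc N * g * ε
        ≈⟨ +-cong (*-congˡ (sym pascal)) (solve 3 (λ a g e → a :* g :* e := a :* (e :* g)) refl _ _ _) ⟩
      - 1# * ε * gauss z (suc N ℕ.+ suc j) (suc j) + z ^ suc N * (ε * g) ∎
      where
      z g : Carrier
      z = q ^ 3
      g = gauss z (suc N ℕ.+ j) j
      pascal : gauss z (suc N ℕ.+ suc j) (suc j) ≈ z ^ suc N * g + gauss z (N ℕ.+ suc j) (suc j)
      pascal = begin
        gauss z (suc (N ℕ.+ suc j)) (suc j)
          ≈⟨ gauss-pascal z (N ℕ.+ suc j) j ⟩
        z ^ (N ℕ.+ suc j ∸ j) * gauss z (N ℕ.+ suc j) j + gauss z (N ℕ.+ suc j) (suc j)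
          ≡⟨ ≡.cong (λ n → z ^ (n ∸ j) * gauss z n j + gauss z (N ℕ.+ suc j) (suc j)) (ℕ.+-suc N j) ⟩
        z ^ (suc N ℕ.+ j ∸ j) * g + gauss z (N ℕ.+ suc j) (suc j)
          ≡⟨ ≡.cong (λ n → z ^ n * g + gauss z (N ℕ.+ suc j) (suc j)) (ℕ.m+n∸n≡m (suc N) j) ⟩
        z ^ suc N * g + gauss z (N ℕ.+ suc j) (suc j) ∎

  -- The double sum A(x) and its three-term recurrence

  module DoubleSum (x : Carrier) (m : ℕ) where

    w : ℕ → Carrier
    w zero    = 1#
    w (suc M) = x * q ^ suc M * w M

    w≈ : ∀ M → w M ≈ x ^ M * q ^ tri (suc M)
    w≈ zero    = sym (*-identityˡ 1#)
    w≈ (suc M) = begin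
      x * q ^ suc M * w M                        ≈⟨ *-congˡ (w≈ M) ⟩
      x * q ^ suc M * (x ^ M * q ^ tri (suc M))
        ≈⟨ solve 4 (λ x a b t → x :* a :* (b :* t) := x :* b :* (a :* t)) refl x (q ^ suc M) (x ^ M) (q ^ tri (suc M)) ⟩
      x ^ suc M * (q ^ suc M * q ^ tri (suc M))  ≈⟨ *-congˡ (^-homo-* q (suc M) (tri (suc M))) ⟨
      x ^ suc M * q ^ tri (suc (suc M))          ∎

    μ : ℕ → ℕ → ℕ
    μ i j = i ℕ.+ 3 ℕ.* j

    μ-suc : ∀ i j → μ i (suc j) ≡ 3 ℕ.+ μ i j
    μ-suc i j = ≡.trans (≡.cong (i ℕ.+_) (ℕ.*-suc 3 j)) (≡.trans (≡.sym (ℕ.+-assoc i 3 (3 ℕ.* j)))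
      (≡.cong (ℕ._+ 3 ℕ.* j) (ℕ.+-comm i 3)))

    i≤μ : ∀ i j → i ≤ μ i j
    i≤μ i j = ℕ.m≤m+n i (3 ℕ.* j)

    j≤μ : ∀ i j → j ≤ μ i j
    j≤μ i j = ℕ.≤-trans (ℕ.m≤n*m j 3) (ℕ.m≤n+m (3 ℕ.* j) i)

    -- With M = i + 3j and N = n - M.  Raising N by one in u alone, or in v alone,
    -- gives the two expressions of A through Y: A-Y₁ and A-Y₃.
    aTerm yTerm : ℕ → ℕ → ℕ → Carrier
    aTerm n i j = delay (μ i j) (λ N → w (μ i j) * (u N i * v N j)) n
    yTerm n i j = delay (μ i j) (λ N → w (μ i j) * (u N i * v (suc N) j)) n

    aRow yRow : ℕ → ℕ → Carrier
    aRow n i = ∑< (suc m) (aTerm n i)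
    yRow n i = ∑< (suc m) (yTerm n i)

    A Y : ℕ → Carrier
    A n = ∑< (suc m) (aRow n)
    Y n = ∑< (suc m) (yRow n)

    yTerm-zero : ∀ n i j → n < μ i j → yTerm n i j ≈ 0#
    yTerm-zero n i j = delay-zero (λ N → w (μ i j) * (u N i * v (suc N) j))

    aTerm-0 : ∀ n j → aTerm (suc n) 0 j ≈ yTerm n 0 j
    aTerm-0 n zero    = refl
    -- The boundary value at N = 0 contains `v 0 (suc j)`, which is 0.
    aTerm-0 n (suc j) = delay-suc (μ 0 (suc j)) _ n
      (λ _ → solve 2 (λ a b → a :* (b :* con 0) := con 0) refl _ _)

    aTerm-i : ∀ n i j → aTerm (suc n) (suc i) j ≈ yTerm n (suc i) j
      + delay (suc (μ i j)) (λ N → w (suc (μ i j)) * (q ^ N * u N i * v (suc N) j)) n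
    aTerm-i n i j = begin
      aTerm (suc n) (suc i) j
        ≈⟨ delay-suc (suc (μ i j)) _ n (λ _ → solve 3 (λ a b c → a :* (b :* con 0 :* c) := con 0) refl _ _ _) ⟩
      delay M (λ N → w M * (u (suc N) (suc i) * v (suc N) j)) n
        ≈⟨ delay-cong M n (λ N _ → trans (*-congˡ (*-congʳ (u-suc N i)))
             (solve 4 (λ w a b c → w :* ((a :+ b) :* c) := w :* (a :* c) :+ w :* (b :* c)) refl _ _ _ _)) ⟩
      delay M (λ N → w M * (u N (suc i) * v (suc N) j) + w M * (q ^ N * u N i * v (suc N) j)) n
        ≈⟨ delay-+ M _ _ n ⟩
      yTerm n (suc i) j + delay M (λ N → w M * (q ^ N * u N i * v (suc N) j)) n ∎
      where
      M : ℕ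
      M = suc (μ i j)

    -- The second part of `u-suc` carries q^N, and passing from M to M + 1 multiplies the weight by
    -- x q^(M+1). As M + N = n, the product x q^(n+1) depends on neither i nor j and can leave the
    -- sum.
    aTerm-suc : ∀ n i j → aTerm (2 ℕ.+ n) (suc i) j ≈ yTerm (1 ℕ.+ n) (suc i) j + x * q * q ^ n * yTerm n i j
    aTerm-suc n i j = trans (aTerm-i (suc n) i j) (+-congˡ (begin
      delay M (λ N → x * q ^ suc M * w M * (q ^ N * u N i * v (suc N) j)) n
        ≈⟨ delay-cong M n weight ⟩
      delay M (λ N → x * q * q ^ n * (w M * (u N i * v (suc N) j))) n
        ≈⟨ delay-*ˡ M _ _ n ⟩
      x * q * q ^ n * yTerm n i j ∎))
      where
      M : ℕ
      M = μ i j
      weight : ∀ N → M ℕ.+ N ≡ n → x * q ^ suc M * w M * (q ^ N * u N i * v (suc N) j)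
                                 ≈ x * q * q ^ n * (w M * (u N i * v (suc N) j))
      weight N ≡.refl = begin
        x * (q * q ^ M) * w M * (q ^ N * u N i * v (suc N) j)
          ≈⟨ solve 7 (λ x q a w b u v → x :* (q :* a) :* w :* (b :* u :* v) := x :* q :* (a :* b) :* (w :* (u :* v)))
               refl x q (q ^ M) (w M) (q ^ N) (u N i) (v (suc N) j) ⟩
        x * q * (q ^ M * q ^ N) * (w M * (u N i * v (suc N) j))
          ≈⟨ *-congʳ (*-congˡ (^-homo-* q M N)) ⟨
        x * q * q ^ (M ℕ.+ N) * (w M * (u N i * v (suc N) j)) ∎

    yRow-zero : ∀ n i → n < i → yRow n i ≈ 0#
    yRow-zero n i n<i = ∑<-zero (suc m) (λ j → yTerm-zero n i j (ℕ.<-≤-trans n<i (i≤μ i j)))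

    A-1 : A 1 ≈ Y 0
    A-1 = +-cong (∑<-cong (suc m) (aTerm-0 0))
      (∑<-cong m (λ i → ∑<-cong (suc m) (λ j → trans (aTerm-i 0 i j) (+-identityʳ _))))

    A-Y₁ : ∀ n → n < m → A (2 ℕ.+ n) ≈ Y (1 ℕ.+ n) + x * q * q ^ n * Y n
    A-Y₁ n n<m = begin
      A (2 ℕ.+ n)
        ≈⟨ ∑<-shift m (aRow (2 ℕ.+ n)) (yRow (1 ℕ.+ n))
             (λ i → γ * yRow n i) (∑<-cong (suc m) (aTerm-0 (suc n)))
             (λ i → trans (∑<-cong (suc m) (aTerm-suc n i))
               (trans (∑<-+ (suc m) (yTerm (1 ℕ.+ n) (suc i)) (λ j → γ * yTerm n i j)) (+-congˡ (∑<-*ˡ (suc m) γ (yTerm n i)))))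
             (trans (*-congˡ (yRow-zero n m n<m)) (zeroʳ γ)) ⟩
      Y (1 ℕ.+ n) + ∑< (suc m) (λ i → γ * yRow n i)
        ≈⟨ +-congˡ (∑<-*ˡ (suc m) γ (yRow n)) ⟩
      Y (1 ℕ.+ n) + γ * Y n ∎
      where
      γ : Carrier
      γ = x * q * q ^ n

    aTerm-j0 : ∀ n i → aTerm n i 0 ≈ yTerm n i 0
    aTerm-j0 n i = delay-cong (μ i 0) n (λ N _ → *-congˡ (*-congˡ (trans (v-zero N) (sym (v-zero (suc N))))))

    aTerm-j : ∀ n i j → aTerm n i (suc j) ≈ yTerm n i (suc j)
      + delay (3 ℕ.+ μ i j) (λ N → w (3 ℕ.+ μ i j) * (u N i * (q ^ N * (q ^ N * q ^ N) * v (suc N) j))) n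
    aTerm-j n i j = begin
      delay M (λ N → w M * (u N i * v N (suc j))) n
        ≈⟨ delay-cong M n (λ N _ → trans (*-congˡ (*-congˡ (v-suc N j)))
             (solve 4 (λ w a b c → w :* (a :* (b :+ c)) := w :* (a :* b) :+ w :* (a :* c)) refl _ _ _ _)) ⟩
      delay M (λ N → w M * (u N i * v (suc N) (suc j)) + w M * (u N i * (q ^ N * (q ^ N * q ^ N) * v (suc N) j))) n
        ≈⟨ delay-+ M _ _ n ⟩
      yTerm n i (suc j) + delay M (λ N → w M * (u N i * (q ^ N * (q ^ N * q ^ N) * v (suc N) j))) n
        ≡⟨ ≡.cong (λ M → yTerm n i (suc j) + delay M (λ N → w M * (u N i * (q ^ N * (q ^ N * q ^ N) * v (suc N) j))) n)
             (μ-suc i j) ⟩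
      _ ∎
      where
      M : ℕ
      M = μ i (suc j)

    -- This is x³ q^(3n+6): the weights x q^(M+1), x q^(M+2), x q^(M+3) collected from M to M + 3,
    -- times the q^(3N) of `v-suc`, with M + N = n.
    cubic : ℕ → Carrier
    cubic n = x * (x * x) * (q ^ 6 * (q ^ n * (q ^ n * q ^ n)))

    aTerm-j-suc : ∀ n i j → aTerm (3 ℕ.+ n) i (suc j) ≈ yTerm (3 ℕ.+ n) i (suc j) + cubic n * yTerm n i j
    aTerm-j-suc n i j = trans (aTerm-j (3 ℕ.+ n) i j) (+-congˡ
      (trans (delay-cong M n weight) (delay-*ˡ M _ _ n)))
      where
      M : ℕ
      M = μ i j
      weight : ∀ N → M ℕ.+ N ≡ n → w (3 ℕ.+ M) * (u N i * (q ^ N * (q ^ N * q ^ N) * v (suc N) j))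
                                 ≈ cubic n * (w M * (u N i * v (suc N) j))
      weight N ≡.refl = trans
        (solve 7 (λ x q a w b u v →
             x :* (q :* (q :* (q :* a))) :* (x :* (q :* (q :* a)) :* (x :* (q :* a) :* w)) :* (u :* (b :* (b :* b) :* v))
             := x :* (x :* x) :* (q :* (q :* (q :* (q :* (q :* (q :* con 1))))) :* ((a :* b) :* ((a :* b) :* (a :* b)))) :* (w :* (u :* v)))
             refl x q (q ^ M) (w M) (q ^ N) (u N i) (v (suc N) j))
        (*-congʳ (*-congˡ (*-congˡ (sym (*-cong e (*-cong e e))))))
        where
        e : q ^ (M ℕ.+ N) ≈ q ^ M * q ^ N
        e = ^-homo-* q M N

    -- The correction term of `aTerm-j` is delayed by at least 3, so it is not yet visible.
    A≈Y : ∀ n → n ≤ 2 → A n ≈ Y n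
    A≈Y n n≤2 = ∑<-cong (suc m) (λ i → +-cong (aTerm-j0 n i) (∑<-cong m (λ j →
      trans (aTerm-j n i j) (trans (+-congˡ (delay-zero _ (s≤s (ℕ.≤-trans n≤2 (ℕ.m≤m+n 2 (μ i j)))))) (+-identityʳ _)))))

    A-Y₃ : ∀ n → n < m → A (3 ℕ.+ n) ≈ Y (3 ℕ.+ n) + cubic n * Y n
    A-Y₃ n n<m = begin
      A (3 ℕ.+ n)
        ≈⟨ ∑<-cong (suc m) row ⟩
      ∑< (suc m) (λ i → yRow (3 ℕ.+ n) i + cubic n * yRow n i)
        ≈⟨ ∑<-+ (suc m) (yRow (3 ℕ.+ n)) (λ i → cubic n * yRow n i) ⟩
      Y (3 ℕ.+ n) + ∑< (suc m) (λ i → cubic n * yRow n i)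
        ≈⟨ +-congˡ (∑<-*ˡ (suc m) (cubic n) (yRow n)) ⟩
      Y (3 ℕ.+ n) + cubic n * Y n ∎
      where
      row : ∀ i → aRow (3 ℕ.+ n) i ≈ yRow (3 ℕ.+ n) i + cubic n * yRow n i
      row i = trans
        (∑<-shift m (aTerm (3 ℕ.+ n) i) (yTerm (3 ℕ.+ n) i) (λ j → cubic n * yTerm n i j) (aTerm-j0 (3 ℕ.+ n) i)
          (aTerm-j-suc n i) (trans (*-congˡ (yTerm-zero n i m (ℕ.<-≤-trans n<m (j≤μ i m)))) (zeroʳ (cubic n))))
        (+-congˡ (∑<-*ˡ (suc m) (cubic n) (yTerm n i)))

    Y-0 : Y 0 ≈ 1#
    Y-0 = begin
      Y 0        ≈⟨ ∑<-head m (yRow 0) (λ i → yRow-zero 0 (suc i) (s≤s z≤n)) ⟩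
      ∑< (suc m) (yTerm 0 0)  ≈⟨ ∑<-head m (yTerm 0 0) (λ j → yTerm-zero 0 0 (suc j) (ℕ.<-≤-trans (s≤s z≤n) (j≤μ 0 (suc j)))) ⟩
      yTerm 0 0 0             ≈⟨ solve 0 (con 1 :* (con 1 :* con 1 :* (con 1 :* con 1)) := con 1) refl ⟩
      1#         ∎

    A-one : A 1 ≈ 1#
    A-one = trans A-1 Y-0

    A-two : 0 < m → A 2 ≈ 1# + x * q
    A-two 0<m = begin
      A 2                       ≈⟨ A-Y₁ 0 0<m ⟩
      Y 1 + x * q * 1# * Y 0    ≈⟨ +-cong (trans (sym (A≈Y 1 (s≤s z≤n))) A-one) (*-congˡ Y-0) ⟩
      1# + x * q * 1# * 1#      ≈⟨ +-congˡ (trans (*-identityʳ _) (*-identityʳ _)) ⟩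
      1# + x * q                ∎

    -- Eliminates `Y`. Expanding the outer two values by `A-Y₁` leaves four consecutive values of
    -- `Y`, which regroup into two copies of the middle value of `A`: one in the form of `A-Y₃`, the
    -- other in the form of `A-Y₁`. At the start `A-1` and `A≈Y` replace the instances that would
    -- reach below `Y 0`.
    A-recurrence : ∀ n → 2 ℕ.+ n ≤ m →
      A (3 ℕ.+ n) + x * x * q ^ 3 * (q ^ n * q ^ n) * A (1 ℕ.+ n) ≈ (1# + x * q ^ 2 * q ^ n) * A (2 ℕ.+ n)
    A-recurrence zero 2≤m = begin
      A 3 + x * x * q ^ 3 * (1# * 1#) * A 1
        ≈⟨ +-cong (A-Y₁ 1 2≤m) (*-congˡ A-1) ⟩
      Y 2 + x * q * (q * 1#) * Y 1 + x * x * q ^ 3 * (1# * 1#) * Y 0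
        ≈⟨ solve 5 (λ x q a b c →
             c :+ x :* q :* (q :* con 1) :* b :+ x :* x :* (q :* (q :* (q :* con 1))) :* (con 1 :* con 1) :* a
             := c :+ x :* (q :* (q :* con 1)) :* con 1 :* (b :+ x :* q :* con 1 :* a)) refl x q (Y 0) (Y 1) (Y 2) ⟩
      Y 2 + x * q ^ 2 * 1# * (Y 1 + x * q * 1# * Y 0)
        ≈⟨ +-cong (A≈Y 2 ℕ.≤-refl) (*-congˡ (A-Y₁ 0 (ℕ.≤-trans (s≤s z≤n) 2≤m))) ⟨
      A 2 + x * q ^ 2 * 1# * A 2
        ≈⟨ solve 2 (λ a b → b :+ a :* b := (con 1 :+ a) :* b) refl _ _ ⟩
      (1# + x * q ^ 2 * 1#) * A 2 ∎
    A-recurrence (suc n) 3+n≤m = begin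
      A (4 ℕ.+ n) + x * x * q ^ 3 * (q * Q * (q * Q)) * A (2 ℕ.+ n)
        ≈⟨ +-cong (A-Y₁ (2 ℕ.+ n) 3+n≤m) (*-congˡ (A-Y₁ n (ℕ.≤-trans (ℕ.m≤n+m (suc n) 2) 3+n≤m))) ⟩
      Y (3 ℕ.+ n) + x * q * (q * (q * Q)) * Y (2 ℕ.+ n) + x * x * q ^ 3 * (q * Q * (q * Q)) * (Y (1 ℕ.+ n) + x * q * Q * Y n)
        ≈⟨ solve 7 (λ x q Q a b c d →
             d :+ x :* q :* (q :* (q :* Q)) :* c
               :+ x :* x :* (q :* (q :* (q :* con 1))) :* (q :* Q :* (q :* Q)) :* (b :+ x :* q :* Q :* a)
             := (d :+ x :* (x :* x) :* (q :* (q :* (q :* (q :* (q :* (q :* con 1))))) :* (Q :* (Q :* Q))) :* a)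
               :+ x :* (q :* (q :* con 1)) :* (q :* Q) :* (c :+ x :* q :* (q :* Q) :* b))
             refl x q Q (Y n) (Y (1 ℕ.+ n)) (Y (2 ℕ.+ n)) (Y (3 ℕ.+ n)) ⟩
      (Y (3 ℕ.+ n) + cubic n * Y n) + x * q ^ 2 * (q * Q) * (Y (2 ℕ.+ n) + x * q * (q * Q) * Y (1 ℕ.+ n))
        ≈⟨ +-cong (A-Y₃ n (ℕ.≤-trans (ℕ.m≤n+m (suc n) 2) 3+n≤m)) (*-congˡ (A-Y₁ (suc n) (ℕ.≤-trans (ℕ.n≤1+n _) 3+n≤m))) ⟨
      A (3 ℕ.+ n) + x * q ^ 2 * (q * Q) * A (3 ℕ.+ n)
        ≈⟨ solve 2 (λ a b → b :+ a :* b := (con 1 :+ a) :* b) refl _ _ ⟩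
      (1# + x * q ^ 2 * (q * Q)) * A (3 ℕ.+ n) ∎
      where
      Q : Carrier
      Q = q ^ n

-- The product formula for Gaussian coefficients

module Pochhammer {c ℓ : Level} (R : CommutativeRing c ℓ) where
  open CommutativeRing R
  open GaussianBinomial R
  open import Algebra.Properties.CommutativeSemiring.Exp commutativeSemiring
  open import Algebra.Properties.Group +-group using () renaming (∙-cancelʳ to +-cancelʳ)
  open import Algebra.Properties.Monoid.Sum *-monoid using () renaming (sum to product)
  open import Algebra.Solver.Ring.NaturalCoefficients.Default commutativeSemiring
    using (solve; _:+_; _:*_; _:=_; con)
  open import Relation.Binary.Reasoning.Setoid setoid

  1-x+x≈1 : ∀ x → 1# + - x + x ≈ 1#
  1-x+x≈1 x = trans (+-assoc _ _ _) (trans (+-congˡ (-‿inverseˡ x)) (+-identityʳ 1#))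

  pochhammer : Carrier → Carrier → ℕ → Carrier
  pochhammer a b n = product {n} (λ i → 1# + - (a * b ^ toℕ i))

  product-last : ∀ n (f : ℕ → Carrier) → product {suc n} (f ∘ toℕ) ≈ product {n} (f ∘ toℕ) * f n
  product-last zero    f = *-comm _ _
  product-last (suc n) f = trans (*-congˡ (product-last n (f ∘ suc))) (sym (*-assoc _ _ _))

  pochhammer-suc : ∀ a b n → pochhammer a b (suc n) ≈ pochhammer a b n * (1# + - (a * b ^ n))
  pochhammer-suc a b n = product-last n (λ i → 1# + - (a * b ^ i))

  -- The defining Pascal rule reduces the inductive step to (1 - y^(B+1)) + y^(B+1) (1 - y^(A+1)) =
  -- 1 - y^(A+B+2).
  gauss-pochhammer : ∀ y A B →
    gauss y (A ℕ.+ B) B * (pochhammer y y A * pochhammer y y B) ≈ pochhammer y y (A ℕ.+ B)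
  gauss-pochhammer y A zero = begin
    1# * (P A * 1#)  ≈⟨ trans (*-identityˡ _) (*-identityʳ _) ⟩
    P A              ≡⟨ ≡.cong P (ℕ.+-identityʳ A) ⟨
    P (A ℕ.+ 0)      ∎
    where
    P : ℕ → Carrier
    P = pochhammer y y
  gauss-pochhammer y zero (suc B) = begin
    gauss y (suc B) (suc B) * (1# * P)  ≈⟨ *-cong (gauss-diagonal y (suc B)) (*-identityˡ P) ⟩
    1# * P                              ≈⟨ *-identityˡ P ⟩
    P                                   ∎
    where
    P : Carrier
    P = pochhammer y y (suc B)
  gauss-pochhammer y (suc A) (suc B) = begin
    (g₀ + r * g₁) * (P (suc A) * P (suc B))
      ≈⟨ distribʳ _ _ _ ⟩
    g₀ * (P (suc A) * P (suc B)) + r * g₁ * (P (suc A) * P (suc B))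
      ≈⟨ +-cong (*-congˡ (*-congˡ (pochhammer-suc y y B))) (*-congˡ (*-congʳ (pochhammer-suc y y A))) ⟩
    g₀ * (P (suc A) * (P B * b)) + r * g₁ * (P A * a * P (suc B))
      ≈⟨ solve 9 (λ g₀ g₁ r a b PA PB QA QB → g₀ :* (QA :* (PB :* b)) :+ r :* g₁ :* (PA :* a :* QB)
           := g₀ :* (QA :* PB) :* b :+ r :* a :* (g₁ :* (PA :* QB))) refl g₀ g₁ r a b (P A) (P B) (P (suc A)) (P (suc B)) ⟩
    g₀ * (P (suc A) * P B) * b + r * a * (g₁ * (P A * P (suc B)))
      ≈⟨ +-cong (*-congʳ ih₀) (*-congˡ (gauss-pochhammer y A (suc B))) ⟩
    P n * b + r * a * P n
      ≈⟨ solve 4 (λ p b r a → p :* b :+ r :* a :* p := p :* (b :+ r :* a)) refl (P n) b r a ⟩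
    P n * (b + r * a)
      ≈⟨ *-congˡ (+-cancelʳ (y * y ^ n) _ _ (trans b+ra+yⁿ⁺¹≈1 (sym (1-x+x≈1 (y * y ^ n))))) ⟩
    P n * (1# + - (y * y ^ n))
      ≈⟨ pochhammer-suc y y n ⟨
    P (suc n) ∎
    where
    P : ℕ → Carrier
    P = pochhammer y y
    n : ℕ
    n = A ℕ.+ suc B
    r a b g₀ g₁ : Carrier
    r = y * y ^ B
    a = 1# + - (y * y ^ A)
    b = 1# + - (y * y ^ B)
    g₀ = gauss y n B
    g₁ = gauss y n (suc B)
    ih₀ : g₀ * (P (suc A) * P B) ≈ P n
    ih₀ rewrite ℕ.+-suc A B = gauss-pochhammer y (suc A) B
    b+ra+yⁿ⁺¹≈1 : b + r * a + y * y ^ n ≈ 1#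
    b+ra+yⁿ⁺¹≈1 = begin
      b + r * a + y * y ^ n          ≈⟨ +-congˡ (*-congˡ (^-homo-* y A (suc B))) ⟩
      b + r * a + y * (y ^ A * r)    ≈⟨ solve 5 (λ y b r a p → b :+ r :* a :+ y :* (p :* r) := b :+ r :* (a :+ y :* p)) refl y b r a (y ^ A) ⟩
      b + r * (a + y * y ^ A)        ≈⟨ +-congˡ (*-congˡ (1-x+x≈1 (y * y ^ A))) ⟩
      b + r * 1#                     ≈⟨ +-congˡ (*-identityʳ r) ⟩
      b + r                          ≈⟨ 1-x+x≈1 r ⟩
      1#                             ∎

-- Both identities from recurrences and initial values

module Identities {c ℓ : Level} (R : CommutativeRing c ℓ) (q : CommutativeRing.Carrier R) where
  open CommutativeRing R
  open FiniteSums R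
  open GaussianBinomial R
  open Pochhammer R
  open Recurrences R q
  open Exponents
  open import Algebra.Properties.CommutativeSemiring.Exp commutativeSemiring
  open import Algebra.Properties.Group +-group using () renaming (∙-cancelʳ to +-cancelʳ)
  open import Algebra.Solver.Ring.NaturalCoefficients.Default commutativeSemiring
    using (solve; _:+_; _:*_; _:=_; con)
  open import Relation.Binary.Reasoning.Setoid setoid

  -- The bound m is carried along because the truncated sums are shown to satisfy their recurrences
  -- only below it; for m = 0 the second initial value is never reached.
  recurrence-unique : ∀ m (α β f g : ℕ → Carrier) →
    (∀ n → 2 ℕ.+ n ≤ m → f (2 ℕ.+ n) + β n * f n ≈ α n * f (1 ℕ.+ n)) →
    (∀ n → 2 ℕ.+ n ≤ m → g (2 ℕ.+ n) + β n * g n ≈ α n * g (1 ℕ.+ n)) →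
    f 0 ≈ g 0 → (1 ≤ m → f 1 ≈ g 1) → ∀ n → n ≤ m → f n ≈ g n
  recurrence-unique m α β f g f-rec g-rec f₀≈g₀ f₁≈g₁ = go
    where
    go : ∀ n → n ≤ m → f n ≈ g n
    go zero          _     = f₀≈g₀
    go (suc zero)    1≤m   = f₁≈g₁ 1≤m
    go (suc (suc n)) 2+n≤m = +-cancelʳ (β n * g n) _ _ (begin
      f (2 ℕ.+ n) + β n * g n  ≈⟨ +-congˡ (*-congˡ (go n (ℕ.≤-trans (ℕ.m≤n+m n 2) 2+n≤m))) ⟨
      f (2 ℕ.+ n) + β n * f n  ≈⟨ f-rec n 2+n≤m ⟩
      α n * f (1 ℕ.+ n)        ≈⟨ *-congˡ (go (suc n) (ℕ.≤-trans (ℕ.n≤1+n _) 2+n≤m)) ⟩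
      α n * g (1 ℕ.+ n)        ≈⟨ g-rec n 2+n≤m ⟨
      g (2 ℕ.+ n) + β n * g n  ∎)

  ^-cube : ∀ e j → q ^ e * (q ^ 3) ^ j ≈ q ^ (3 ℕ.* j ℕ.+ e)
  ^-cube e j = begin
    q ^ e * (q ^ 3) ^ j    ≈⟨ *-comm _ _ ⟩
    (q ^ 3) ^ j * q ^ e    ≈⟨ *-congʳ (^-assocʳ q 3 j) ⟩
    q ^ (3 ℕ.* j) * q ^ e  ≈⟨ ^-homo-* q (3 ℕ.* j) e ⟨
    q ^ (3 ℕ.* j ℕ.+ e)    ∎

  -- Supplies the hypothesis `d-suc` of `BinomialSum` for both residue classes, with k = κ j + 1:
  -- the exponent grows by 2k and the new Pochhammer factor is 1 - q^k.
  weighted-pochhammer-suc : ∀ a (e : ℕ → ℕ) k j → e (suc j) ≡ k ℕ.+ (k ℕ.+ e j) → a * (q ^ 3) ^ j ≈ q ^ k →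
    q ^ e (suc j) * pochhammer a (q ^ 3) (suc j) ≈ q ^ k * (q ^ k * (1# + - q ^ k)) * (q ^ e j * pochhammer a (q ^ 3) j)
  weighted-pochhammer-suc a e k j e-suc aq³ʲ≈qᵏ = begin
    q ^ e (suc j) * pochhammer a (q ^ 3) (suc j)
      ≈⟨ *-cong (trans (^-congʳ q e-suc) (trans (^-homo-* q k _) (*-congˡ (^-homo-* q k _))))
                (trans (pochhammer-suc a (q ^ 3) j) (*-congˡ (+-congˡ (-‿cong aq³ʲ≈qᵏ)))) ⟩
    q ^ k * (q ^ k * q ^ e j) * (pochhammer a (q ^ 3) j * (1# + - q ^ k))
      ≈⟨ solve 4 (λ a b p t → a :* (a :* b) :* (p :* t) := a :* (a :* t) :* (b :* p)) refl _ _ _ _ ⟩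
    q ^ k * (q ^ k * (1# + - q ^ k)) * (q ^ e j * pochhammer a (q ^ 3) j) ∎

  d₀ d₁ : ℕ → Carrier
  d₀ j = q ^ (j ℕ.* (3 ℕ.* j ∸ 1)) * pochhammer q (q ^ 3) j
  d₁ j = q ^ (j ℕ.* (3 ℕ.* j ℕ.+ 1)) * pochhammer (q ^ 2) (q ^ 3) j

  module _ (m : ℕ) where
    open DoubleSum 1# m using (A; A-one; A-two; A-recurrence)
    open DoubleSum q m using () renaming (A to A′; A-one to A′-one; A-two to A′-two; A-recurrence to A′-recurrence)

    open BinomialSum (λ j → 3 ℕ.* j ℕ.+ 1) (s≤s z≤n) (λ j → ≡.cong (ℕ._+ 1) (ℕ.*-suc 3 j))
      d₁ (λ j → 1# + - q ^ suc (3 ℕ.* j ℕ.+ 1))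
      (λ j → 1-x+x≈1 _)
      (λ j → weighted-pochhammer-suc (q ^ 2) (λ j → j ℕ.* (3 ℕ.* j ℕ.+ 1)) (suc (3 ℕ.* j ℕ.+ 1)) j
        (j[3j+1]-suc j)
        (trans (^-cube 2 j) (^-congʳ q (ℕ.+-suc (3 ℕ.* j) 1))))
      m public using () renaming (S to S₁; S-recurrence to S₁-recurrence)

    open BinomialSum (λ j → 3 ℕ.* j) z≤n (ℕ.*-suc 3)
      d₀ (λ j → 1# + - q ^ suc (3 ℕ.* j))
      (λ j → 1-x+x≈1 _)
      (λ j → weighted-pochhammer-suc q (λ j → j ℕ.* (3 ℕ.* j ∸ 1)) (suc (3 ℕ.* j)) j (j[3j∸1]-suc j)
        (trans (*-congʳ (sym (*-identityʳ q))) (trans (^-cube 1 j) (^-congʳ q (ℕ.+-comm (3 ℕ.* j) 1)))))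
      m public using () renaming (S to S₀; S-recurrence to S₀-recurrence)

    S₁-zero : S₁ 0 ≈ 0#
    S₁-zero = ∑<-zero (suc m) (λ j → trans (*-congˡ (gauss-zero q (ℕ.m≤n+m 1 (3 ℕ.* j)))) (zeroʳ (d₁ j)))

    S₁-one : S₁ 1 ≈ 1#
    S₁-one = trans
      (∑<-head m (λ j → d₁ j * gauss q 1 (3 ℕ.* j ℕ.+ 1)) (λ j → trans (*-congˡ (gauss-zero q (1<κ j))) (zeroʳ (d₁ (suc j)))))
      (trans (*-cong (*-identityˡ 1#) (gauss-diagonal q 1)) (*-identityˡ 1#))
      where
      1<κ : ∀ j → 1 < 3 ℕ.* suc j ℕ.+ 1
      1<κ j = ≡.subst (1 <_) (≡.cong (ℕ._+ 1) (≡.sym (ℕ.*-suc 3 j))) (s≤s (s≤s z≤n))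

    S₀-zero : S₀ 0 ≈ 1#
    S₀-zero = trans
      (∑<-head m (λ j → d₀ j * gauss q 0 (3 ℕ.* j)) (λ j → zeroʳ (d₀ (suc j))))
      (trans (*-identityʳ _) (*-identityˡ 1#))

    S₀-one : S₀ 1 ≈ 1#
    S₀-one = trans
      (∑<-head m (λ j → d₀ j * gauss q 1 (3 ℕ.* j)) (λ j → trans (*-congˡ (gauss-zero q (1<κ j))) (zeroʳ (d₀ (suc j)))))
      (trans (*-identityʳ _) (*-identityˡ 1#))
      where
      1<κ : ∀ j → 1 < 3 ℕ.* suc j
      1<κ j = ≡.subst (1 <_) (≡.sym (ℕ.*-suc 3 j)) (s≤s (s≤s z≤n))

    -- These are q^(2n+3) and 1 + q^(n+2), the coefficients for sequences shifted by one, as the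
    -- recurrence of `A` starts from `A 1`.
    β α : ℕ → Carrier
    β n = q * (q * q ^ n * (q * q ^ n))
    α n = 1# + q * (q * q ^ n)

    A-rec : ∀ n → 2 ℕ.+ n ≤ m → A (3 ℕ.+ n) + β n * A (1 ℕ.+ n) ≈ α n * A (2 ℕ.+ n)
    A-rec n 2+n≤m = begin
      A (3 ℕ.+ n) + β n * A (1 ℕ.+ n)
        ≈⟨ +-congˡ (*-congʳ (solve 2 (λ q Q → q :* (q :* Q :* (q :* Q)) := con 1 :* con 1 :* (q :* (q :* (q :* con 1))) :* (Q :* Q)) refl q (q ^ n))) ⟩
      A (3 ℕ.+ n) + 1# * 1# * q ^ 3 * (q ^ n * q ^ n) * A (1 ℕ.+ n)
        ≈⟨ A-recurrence n 2+n≤m ⟩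
      (1# + 1# * q ^ 2 * q ^ n) * A (2 ℕ.+ n)
        ≈⟨ *-congʳ (solve 2 (λ q Q → con 1 :+ con 1 :* (q :* (q :* con 1)) :* Q := con 1 :+ q :* (q :* Q)) refl q (q ^ n)) ⟩
      α n * A (2 ℕ.+ n) ∎

    first-identity : ∀ n → suc n ≤ m → A (suc n) ≈ S₁ (suc n)
    first-identity n 1+n≤m = recurrence-unique m α β (A ∘ suc) (S₁ ∘ suc) A-rec
      (λ n 2+n≤m → S₁-recurrence (suc n) (ℕ.≤-trans (ℕ.n≤1+n _) 2+n≤m))
      (trans A-one (sym S₁-one)) A₂≈S₂ n (ℕ.≤-trans (ℕ.n≤1+n n) 1+n≤m)
      where
      A₂≈S₂ : 1 ≤ m → A 2 ≈ S₁ 2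
      -- The recurrence of `S₁` is available one index earlier than that of `A`; with `S₁ 0` equal
      -- to 0 it yields `S₁ 2` without expanding the sum.
      A₂≈S₂ 0<m = begin
        A 2                            ≈⟨ A-two 0<m ⟩
        1# + 1# * q                    ≈⟨ solve 1 (λ q → con 1 :+ con 1 :* q := (con 1 :+ q :* con 1) :* con 1) refl q ⟩
        (1# + q * 1#) * 1#             ≈⟨ *-congˡ S₁-one ⟨
        (1# + q * 1#) * S₁ 1           ≈⟨ S₁-recurrence 0 z≤n ⟨
        S₁ 2 + q * (1# * 1#) * S₁ 0    ≈⟨ +-congˡ (trans (*-congˡ S₁-zero) (zeroʳ _)) ⟩
        S₁ 2 + 0#                      ≈⟨ +-identityʳ _ ⟩
        S₁ 2                           ∎

    -- C n is q times the second double sum of the second identity for n + 1; that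
    -- sum vanishes for n = 0, whereas A′ 0 is 1.
    C : ℕ → Carrier
    C zero    = 0#
    C (suc n) = q * A′ (suc n)

    -- At x = q the coefficients x² q^(2n+3) and 1 + x q^(n+2) are β and α at n + 1, so multiplying
    -- by q and delaying by one brings `A′` into the recurrence of `A`. The first instance, where
    -- `C 0` is 0, rests on `A-two`.
    C-recurrence : ∀ n → 2 ℕ.+ n ≤ m → C (2 ℕ.+ n) + β n * C n ≈ α n * C (1 ℕ.+ n)
    C-recurrence zero 2≤m = begin
      q * A′ 2 + β 0 * 0#             ≈⟨ +-congʳ (*-congˡ (A′-two (ℕ.≤-trans (s≤s z≤n) 2≤m))) ⟩
      q * (1# + q * q) + β 0 * 0#     ≈⟨ solve 2 (λ q b → q :* (con 1 :+ q :* q) :+ b :* con 0 := (con 1 :+ q :* (q :* con 1)) :* (q :* con 1)) refl q (β 0) ⟩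
      α 0 * (q * 1#)                  ≈⟨ *-congˡ (*-congˡ A′-one) ⟨
      α 0 * (q * A′ 1)                ∎
    C-recurrence (suc n) 3+n≤m = begin
      q * A′ (3 ℕ.+ n) + β (suc n) * (q * A′ (1 ℕ.+ n))
        ≈⟨ solve 4 (λ q Q a b → q :* b :+ q :* (q :* (q :* Q) :* (q :* (q :* Q))) :* (q :* a)
             := q :* (b :+ q :* q :* (q :* (q :* (q :* con 1))) :* (Q :* Q) :* a)) refl q (q ^ n) (A′ (1 ℕ.+ n)) (A′ (3 ℕ.+ n)) ⟩
      q * (A′ (3 ℕ.+ n) + q * q * q ^ 3 * (q ^ n * q ^ n) * A′ (1 ℕ.+ n))
        ≈⟨ *-congˡ (A′-recurrence n (ℕ.≤-trans (ℕ.n≤1+n _) 3+n≤m)) ⟩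
      q * ((1# + q * q ^ 2 * q ^ n) * A′ (2 ℕ.+ n))
        ≈⟨ solve 3 (λ q Q a → q :* ((con 1 :+ q :* (q :* (q :* con 1)) :* Q) :* a)
             := (con 1 :+ q :* (q :* (q :* Q))) :* (q :* a)) refl q (q ^ n) (A′ (2 ℕ.+ n)) ⟩
      α (suc n) * (q * A′ (2 ℕ.+ n)) ∎

    -- The recurrence is linear, so the sum of the two solutions satisfies it again. Keeping `C` on
    -- the right avoids subtraction.
    second-identity : ∀ n → suc n ≤ m → A (suc n) ≈ S₀ (suc n) + C n
    second-identity n 1+n≤m = recurrence-unique m α β (A ∘ suc) (λ n → S₀ (suc n) + C n) A-rec S+C-rec
      (trans A-one (trans (sym S₀-one) (sym (+-identityʳ _)))) base n (ℕ.≤-trans (ℕ.n≤1+n n) 1+n≤m)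
      where
      S+C-rec : ∀ n → 2 ℕ.+ n ≤ m → S₀ (3 ℕ.+ n) + C (2 ℕ.+ n) + β n * (S₀ (1 ℕ.+ n) + C n) ≈ α n * (S₀ (2 ℕ.+ n) + C (1 ℕ.+ n))
      S+C-rec n 2+n≤m = begin
        S₀ (3 ℕ.+ n) + C (2 ℕ.+ n) + β n * (S₀ (1 ℕ.+ n) + C n)
          ≈⟨ solve 5 (λ s c b s′ c′ → s :+ c :+ b :* (s′ :+ c′) := (s :+ b :* s′) :+ (c :+ b :* c′)) refl _ _ _ _ _ ⟩
        (S₀ (3 ℕ.+ n) + β n * S₀ (1 ℕ.+ n)) + (C (2 ℕ.+ n) + β n * C n)
          ≈⟨ +-cong (S₀-recurrence (suc n) (ℕ.≤-trans (ℕ.n≤1+n _) 2+n≤m)) (C-recurrence n 2+n≤m) ⟩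
        α n * S₀ (2 ℕ.+ n) + α n * C (1 ℕ.+ n)
          ≈⟨ distribˡ _ _ _ ⟨
        α n * (S₀ (2 ℕ.+ n) + C (1 ℕ.+ n)) ∎

      base : 1 ≤ m → A 2 ≈ S₀ 2 + q * A′ 1
      base 0<m = begin
        A 2                          ≈⟨ A-two 0<m ⟩
        1# + 1# * q                  ≈⟨ solve 1 (λ q → con 1 :+ con 1 :* q := (con 1 :+ q :* con 1) :* con 1) refl q ⟩
        (1# + q * 1#) * 1#           ≈⟨ *-congˡ S₀-one ⟨
        (1# + q * 1#) * S₀ 1         ≈⟨ S₀-recurrence 0 z≤n ⟨
        -- Now `S₀ 0` is 1, in contrast to `S₁ 0`, and the resulting surplus q is `C 1`.
        S₀ 2 + q * (1# * 1#) * S₀ 0  ≈⟨ +-congˡ (trans (*-cong (*-congˡ (*-identityˡ 1#)) S₀-zero) (*-identityʳ _)) ⟩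
        S₀ 2 + q * 1#                ≈⟨ +-congˡ (*-congˡ A′-one) ⟨
        S₀ 2 + q * A′ 1              ∎

open import Defs

-- The commutative ring of formal power series

module PowerSeries where
  open ≡-Reasoning
  open FiniteSums ℤ.+-*-commutativeRing
  open import Algebra.Solver.Ring.NaturalCoefficients.Default
    (CommutativeRing.commutativeSemiring ℤ.+-*-commutativeRing)
    using (solve; _:+_; _:*_; _:=_; con)

  -- Since sums unfold at the head, `(f · g) (suc k)` is by computation
  -- `f 0 ℤ.* g (suc k) ℤ.+ (shift f · g) k`; this drives the inductions on the coefficient index.
  shift : Series → Series
  shift f k = f (suc k)

  ·-cong-≤ : ∀ k {f f′ g g′ : Series} → f ≈ f′ → (∀ i → i ≤ k → g i ≡ g′ i) → (f · g) k ≡ (f′ · g′) k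
  ·-cong-≤ k f≈f′ g≈g′ = ∑<-cong (suc k) (λ i → ≡.cong₂ ℤ._*_ (f≈f′ i) (g≈g′ (k ∸ i) (ℕ.m∸n≤m k i)))

  ·-cong : ∀ {f f′ g g′ : Series} → f ≈ f′ → g ≈ g′ → f · g ≈ f′ · g′
  ·-cong f≈f′ g≈g′ k = ·-cong-≤ k f≈f′ (λ i _ → g≈g′ i)

  ·-zeroˡ : ∀ g → 0# · g ≈ 0#
  ·-zeroˡ g k = ∑<-zero (suc k) (λ i → ≡.refl)

  -- Peels off the last term instead of the first. It is the mirror image of the head unfolding, as
  -- commutativity requires.
  ·-suc-right : ∀ (f g : Series) k → (f · g) (suc k) ≡ (f · shift g) k ℤ.+ f (suc k) ℤ.* g 0
  ·-suc-right f g zero    = solve 2 (λ a b → a :+ (b :+ con 0) := (a :+ con 0) :+ b) ≡.refl (f 0 ℤ.* g 1) (f 1 ℤ.* g 0)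
  ·-suc-right f g (suc k) = begin
    f 0 ℤ.* g (2 ℕ.+ k) ℤ.+ (shift f · g) (suc k)
      ≡⟨ ≡.cong (λ a → f 0 ℤ.* g (2 ℕ.+ k) ℤ.+ a) (·-suc-right (shift f) g k) ⟩
    f 0 ℤ.* g (2 ℕ.+ k) ℤ.+ ((shift f · shift g) k ℤ.+ f (2 ℕ.+ k) ℤ.* g 0)
      ≡⟨ ℤ.+-assoc (f 0 ℤ.* g (2 ℕ.+ k)) _ _ ⟨
    (f · shift g) (suc k) ℤ.+ f (2 ℕ.+ k) ℤ.* g 0 ∎

  ·-comm : ∀ f g → f · g ≈ g · f
  ·-comm f g zero    = ≡.cong (ℤ._+ 0ℤ) (ℤ.*-comm (f 0) (g 0))
  ·-comm f g (suc k) = begin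
    f 0 ℤ.* g (suc k) ℤ.+ (shift f · g) k  ≡⟨ ≡.cong₂ ℤ._+_ (ℤ.*-comm (f 0) (g (suc k))) (·-comm (shift f) g k) ⟩
    g (suc k) ℤ.* f 0 ℤ.+ (g · shift f) k  ≡⟨ ℤ.+-comm (g (suc k) ℤ.* f 0) _ ⟩
    (g · shift f) k ℤ.+ g (suc k) ℤ.* f 0  ≡⟨ ·-suc-right g f k ⟨
    (g · f) (suc k)                        ∎

  ·-distribʳ : ∀ h f g → (f ⊕ g) · h ≈ (f · h) ⊕ (g · h)
  ·-distribʳ h f g k = ≡.trans
    (∑<-cong (suc k) (λ i → ℤ.*-distribʳ-+ (h (k ∸ i)) (f i) (g i)))
    (∑<-+ (suc k) (λ i → f i ℤ.* h (k ∸ i)) (λ i → g i ℤ.* h (k ∸ i)))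

  ·-distribˡ : ∀ h f g → h · (f ⊕ g) ≈ (h · f) ⊕ (h · g)
  ·-distribˡ h f g k = begin
    (h · (f ⊕ g)) k            ≡⟨ ·-comm h (f ⊕ g) k ⟩
    ((f ⊕ g) · h) k            ≡⟨ ·-distribʳ h f g k ⟩
    (f · h) k ℤ.+ (g · h) k    ≡⟨ ≡.cong₂ ℤ._+_ (·-comm f h k) (·-comm g h k) ⟩
    (h · f) k ℤ.+ (h · g) k    ∎

  scale : ℤ → Series → Series
  scale a f k = a ℤ.* f k

  scale-· : ∀ a f g → scale a f · g ≈ scale a (f · g)
  scale-· a f g k = ≡.trans
    (∑<-cong (suc k) (λ i → ℤ.*-assoc a (f i) (g (k ∸ i))))
    (∑<-*ˡ (suc k) a (λ i → f i ℤ.* g (k ∸ i)))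

  ·-assoc : ∀ f g h → (f · g) · h ≈ f · (g · h)
  ·-assoc f g h zero    = solve 3 (λ a b c → (a :* b :+ con 0) :* c :+ con 0 := a :* (b :* c :+ con 0) :+ con 0) ≡.refl (f 0) (g 0) (h 0)
  ·-assoc f g h (suc k) = begin
    (f 0 ℤ.* g 0 ℤ.+ 0ℤ) ℤ.* h (suc k) ℤ.+ ((scale (f 0) (shift g) ⊕ (shift f · g)) · h) k
      -- The series multiplied by `h` is `shift (f · g)`, unfolded by computation.
      ≡⟨ ≡.cong (λ a → r ℤ.+ a) (·-distribʳ h (scale (f 0) (shift g)) (shift f · g) k) ⟩
    (f 0 ℤ.* g 0 ℤ.+ 0ℤ) ℤ.* h (suc k) ℤ.+ ((scale (f 0) (shift g) · h) k ℤ.+ ((shift f · g) · h) k)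
      ≡⟨ ≡.cong₂ (λ a b → r ℤ.+ (a ℤ.+ b)) (scale-· (f 0) (shift g) h k) (·-assoc (shift f) g h k) ⟩
    (f 0 ℤ.* g 0 ℤ.+ 0ℤ) ℤ.* h (suc k) ℤ.+ (f 0 ℤ.* (shift g · h) k ℤ.+ (shift f · (g · h)) k)
      ≡⟨ solve 5 (λ a b c d e → (a :* b :+ con 0) :* c :+ (a :* d :+ e) := a :* (b :* c :+ d) :+ e) ≡.refl (f 0) (g 0) (h (suc k)) ((shift g · h) k) ((shift f · (g · h)) k) ⟩
    f 0 ℤ.* (g · h) (suc k) ℤ.+ (shift f · (g · h)) k ∎
    where
    r : ℤ
    r = (f 0 ℤ.* g 0 ℤ.+ 0ℤ) ℤ.* h (suc k)

  ·-identityˡ : ∀ f → 1# · f ≈ f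
  ·-identityˡ f zero    = ≡.trans (ℤ.+-identityʳ _) (ℤ.*-identityˡ (f 0))
  ·-identityˡ f (suc k) = begin
    1ℤ ℤ.* f (suc k) ℤ.+ (0# · f) k  ≡⟨ ≡.cong₂ ℤ._+_ (ℤ.*-identityˡ (f (suc k))) (·-zeroˡ f k) ⟩
    f (suc k) ℤ.+ 0ℤ                 ≡⟨ ℤ.+-identityʳ _ ⟩
    f (suc k)                        ∎

  ℤ⟦q⟧-commutativeRing : CommutativeRing 0ℓ 0ℓ
  ℤ⟦q⟧-commutativeRing = record
    { _≈_ = _≈_
    ; _+_ = _⊕_
    ; _*_ = _·_
    ; -_  = ⊝_
    ; 0#  = 0#
    ; 1#  = 1#
    ; isCommutativeRing = record
      { isRing = record
        { +-isAbelianGroup = record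
          { isGroup = record
            { isMonoid = record
              { isSemigroup = record
                { isMagma = record
                  { isEquivalence = record
                    { refl  = λ k → ≡.refl
                    ; sym   = λ f≈g k → ≡.sym (f≈g k)
                    ; trans = λ f≈g g≈h k → ≡.trans (f≈g k) (g≈h k)
                    }
                  ; ∙-cong = λ f≈f′ g≈g′ k → ≡.cong₂ ℤ._+_ (f≈f′ k) (g≈g′ k)
                  }
                ; assoc = λ f g h k → ℤ.+-assoc (f k) (g k) (h k)
                }
              ; identity = (λ f k → ℤ.+-identityˡ (f k)) , (λ f k → ℤ.+-identityʳ (f k))
              }
            ; inverse = (λ f k → ℤ.+-inverseˡ (f k)) , (λ f k → ℤ.+-inverseʳ (f k))
            ; ⁻¹-cong = λ f≈g k → ≡.cong ℤ.-_ (f≈g k)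
            }
          ; comm = λ f g k → ℤ.+-comm (f k) (g k)
          }
        ; *-cong     = ·-cong
        ; *-assoc    = ·-assoc
        ; *-identity = ·-identityˡ , (λ f k → ≡.trans (·-comm f 1# k) (·-identityˡ f k))
        ; distrib    = ·-distribˡ , ·-distribʳ
        }
      ; *-comm = ·-comm
      }
    }

-- Reciprocals of series and q-binomials as Gaussian coefficients

module Quotients where
  open PowerSeries
  open CommutativeRing ℤ⟦q⟧-commutativeRing
    using (sym; trans; *-congˡ; *-congʳ; *-identityʳ; *-assoc; zeroʳ; +-comm)
  open FiniteSums ℤ⟦q⟧-commutativeRing
  open GaussianBinomial ℤ⟦q⟧-commutativeRing
  open Pochhammer ℤ⟦q⟧-commutativeRing
  open ≡-Reasoning

  ·-constant : ∀ (f g : Series) → (f · g) 0 ≡ f 0 ℤ.* g 0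
  ·-constant f g = ℤ.+-identityʳ _

  -- A series without constant term is divisible by q, hence its e-th power by q^e.
  ^-vanishes : ∀ (h : Series) → h 0 ≡ 0ℤ → ∀ e k → k < e → (h ^ e) k ≡ 0ℤ
  ^-vanishes h h₀≡0 (suc e) zero    _         = ≡.trans (·-constant h (h ^ e)) (≡.cong (ℤ._* (h ^ e) 0) h₀≡0)
  ^-vanishes h h₀≡0 (suc e) (suc k) (s≤s k<e) = ≡.cong₂ ℤ._+_ (≡.cong (ℤ._* (h ^ e) (suc k)) h₀≡0) (begin
    (shift h · (h ^ e)) k  ≡⟨ ·-cong-≤ k {shift h} (λ _ → ≡.refl) (λ i i≤k → ^-vanishes h h₀≡0 e i (ℕ.≤-<-trans i≤k k<e)) ⟩
    (shift h · 0#) k       ≡⟨ zeroʳ (shift h) k ⟩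
    0ℤ                     ∎)

  -- `recip g` truncates the geometric series differently at each coefficient. By `G-stable` every
  -- coefficient i ≤ k may use the truncation `G k`, and the remainder h^(k+1) of `geometric` does
  -- not reach degree k.
  ·-recip : ∀ (g : Series) → g 0 ≡ 1ℤ → g · recip g ≈ 1#
  ·-recip g g₀≡1 k = begin
    (g · recip g) k                        ≡⟨ ·-cong-≤ k {g} (λ _ → ≡.refl) (λ i i≤k → ≡.trans (≡.sym (G-stable i (k ∸ i)))
                                                (≡.cong (λ n → G n i) (ℕ.m+[n∸m]≡n i≤k))) ⟩
    (g · G k) k                            ≡⟨ ℤ.+-identityʳ _ ⟨
    (g · G k) k ℤ.+ 0ℤ                     ≡⟨ ≡.cong (λ a → (g · G k) k ℤ.+ a) (^-vanishes h h₀≡0 (suc k) k (ℕ.n<1+n k)) ⟨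
    (g · G k) k ℤ.+ (h ^ suc k) k          ≡⟨ geometric g h (trans (+-comm g h) (1-x+x≈1 g)) (suc k) k ⟩
    1# k                                   ∎
    where
    h : Series
    h = 1# ⊖ g
    h₀≡0 : h 0 ≡ 0ℤ
    h₀≡0 = ≡.cong (λ a → 1ℤ ℤ.- a) g₀≡1
    G : ℕ → Series
    G n = ∑[ e ≤ n ] h ^ e
    G-stable : ∀ k d → G (k ℕ.+ d) k ≡ G k k
    G-stable k zero    = ≡.cong (λ n → G n k) (ℕ.+-identityʳ k)
    G-stable k (suc d) = begin
      G (k ℕ.+ suc d) k                                ≡⟨ ≡.cong (λ n → G n k) (ℕ.+-suc k d) ⟩
      G (suc (k ℕ.+ d)) k                              ≡⟨ ∑<-last (suc (k ℕ.+ d)) (h ^_) k ⟩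
      G (k ℕ.+ d) k ℤ.+ (h ^ suc (k ℕ.+ d)) k          ≡⟨ ≡.cong₂ ℤ._+_ (G-stable k d)
                                                            (^-vanishes h h₀≡0 (suc (k ℕ.+ d)) k (s≤s (ℕ.m≤m+n k d))) ⟩
      G k k ℤ.+ 0ℤ                                     ≡⟨ ℤ.+-identityʳ _ ⟩
      G k k                                            ∎

  ÷-unique : ∀ (p x d : Series) → d 0 ≡ 1ℤ → x · d ≈ p → p ÷ d ≈ x
  ÷-unique p x d d₀≡1 xd≈p = trans (*-congʳ {recip d} (sym {x · d} xd≈p)) (trans (*-assoc x d (recip d))
    (trans (*-congˡ {x} (·-recip d d₀≡1)) (*-identityʳ x)))

  product-constant : ∀ n (f : ℕ → Series) → (∀ i → f i 0 ≡ 1ℤ) → product {n} (λ i → f (toℕ i)) 0 ≡ 1ℤ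
  product-constant zero    f f₀≡1 = ≡.refl
  product-constant (suc n) f f₀≡1 = ≡.trans (·-constant (f 0) (product {n} (λ i → f (suc (toℕ i)))))
    (≡.cong₂ ℤ._*_ (f₀≡1 0) (product-constant n (λ i → f (suc i)) (λ i → f₀≡1 (suc i))))

  poch-constant : ∀ (b : Series) → b 0 ≡ 0ℤ → ∀ n → poch b b n 0 ≡ 1ℤ
  poch-constant b b₀≡0 n = product-constant n (λ i → 1# ⊖ b · b ^ i)
    (λ i → ≡.cong (λ a → 1ℤ ℤ.- a) (≡.trans (·-constant b (b ^ i)) (≡.cong (ℤ._* (b ^ i) 0) b₀≡0)))

  qbinomial⁺≈gauss : ∀ (b : Series) → b 0 ≡ 0ℤ → ∀ A B → qbinomial⁺ b (+ A) (+ B) ≈ gauss b (A ℕ.+ B) B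
  qbinomial⁺≈gauss b b₀≡0 A B = ÷-unique (poch b b (A ℕ.+ B)) (gauss b (A ℕ.+ B) B) (poch b b A · poch b b B)
    (≡.trans (·-constant (poch b b A) (poch b b B)) (≡.cong₂ ℤ._*_ (poch-constant b b₀≡0 A) (poch-constant b b₀≡0 B)))
    (gauss-pochhammer b A B)

  qbinomial≈gauss : ∀ (b : Series) → b 0 ≡ 0ℤ → ∀ N B → qbinomial b (+ N) (+ B) ≈ gauss b N B
  qbinomial≈gauss b b₀≡0 N B with ℕ.≤-<-connex B N
  ... | inj₁ B≤N rewrite ℤ.m-n≡m⊖n N B | ℤ.⊖-≥ B≤N =
    λ k → ≡.trans (qbinomial⁺≈gauss b b₀≡0 (N ∸ B) B k) (≡.cong (λ n → gauss b n B k) (ℕ.m∸n+n≡m B≤N))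
  -- Exposing `B ∸ N` as a successor lets the integer difference compute to a negative constructor,
  -- on which `qbinomial⁺` is 0.
  ... | inj₂ N<B rewrite ℤ.m-n≡m⊖n N B | ℤ.⊖-< N<B with B ∸ N | ℕ.m<n⇒0<n∸m N<B
  ...   | suc _ | _ = sym {gauss b N B} (gauss-zero b N<B)

  qbinomial-negative : ∀ (b : Series) a B → qbinomial b -[1+ a ] (+ B) ≈ 0#
  qbinomial-negative b a zero    k = ≡.refl
  qbinomial-negative b a (suc B) k = ≡.refl

open import Data.Nat.Base using (_+_; _*_)
open import Data.Nat.DivMod using (_/_)

-- Integer differences occurring as upper indices

module IndexArithmetic where
  open ℤ.+-*-Solver using (solve; _:+_; _:-_; :-_; _:=_; con)
  open ≡-Reasoning

  +[a+b+k]-a-b : ∀ a b k → + (a + b + k) - + a - + b ≡ + k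
  +[a+b+k]-a-b a b k = begin
    + (a + b + k) - + a - + b          ≡⟨ ≡.cong (λ z → z - + a - + b) (≡.trans (ℤ.pos-+ (a + b) k) (≡.cong (ℤ._+ + k) (ℤ.pos-+ a b))) ⟩
    + a ℤ.+ + b ℤ.+ + k - + a - + b    ≡⟨ solve 3 (λ a b k → a :+ b :+ k :- a :- b := k) ≡.refl (+ a) (+ b) (+ k) ⟩
    + k                                ∎

  n-a-b≡-k : ∀ {n a b k} → n + k ≡ a + b → + n - + a - + b ≡ ℤ.- + k
  n-a-b≡-k {n} {a} {b} {k} n+k≡a+b = begin
    + n - + a - + b            ≡⟨ solve 3 (λ n a b → n :- a :- b := n :- (a :+ b)) ≡.refl (+ n) (+ a) (+ b) ⟩
    + n - (+ a ℤ.+ + b)        ≡⟨ ≡.cong (λ z → + n - z) (≡.trans (≡.sym (ℤ.pos-+ a b)) (≡.trans (≡.cong +_ (≡.sym n+k≡a+b)) (ℤ.pos-+ n k))) ⟩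
    + n - (+ n ℤ.+ + k)        ≡⟨ solve 2 (λ n k → n :- (n :+ k) := :- k) ≡.refl (+ n) (+ k) ⟩
    ℤ.- + k                    ∎

  [1+n]-a-b-1 : ∀ n a b → + suc n - + a - + b - + 1 ≡ + n - + a - + b
  [1+n]-a-b-1 n a b = solve 3 (λ n a b → con 1ℤ :+ n :- a :- b :- con 1ℤ := n :- a :- b) ≡.refl (+ n) (+ a) (+ b)

  [1+n]-a-b-2 : ∀ n a b → + suc n - + a - + b - + 2 ≡ + n - + a - + b - + 1
  [1+n]-a-b-2 n a b = solve 3 (λ n a b → con 1ℤ :+ n :- a :- b :- con (+ 2) := n :- a :- b :- con 1ℤ) ≡.refl (+ n) (+ a) (+ b)

open PowerSeries
open Quotients
open IndexArithmetic
open Exponents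
open FiniteSums ℤ⟦q⟧-commutativeRing
open GaussianBinomial ℤ⟦q⟧-commutativeRing
open Recurrences ℤ⟦q⟧-commutativeRing q
open Identities ℤ⟦q⟧-commutativeRing q
module Z = CommutativeRing ℤ⟦q⟧-commutativeRing
import Algebra.Properties.CommutativeSemiring.Exp Z.commutativeSemiring as Exp

summand : ℕ → ℕ → ℤ → ℤ → ℕ → Series
summand i j a b e = (⊝ 1#) ^ j · q ^ e · qbinomial q a (+ i) · qbinomial (q ^ 3) b (+ j)

-- Matching the stated summands with the terms of A(x)

module Terms (x : Series) (m : ℕ) where
  open DoubleSum x m
  open import Algebra.Solver.Ring.NaturalCoefficients.Default Z.commutativeSemiring
    using (solve; _:+_; _:*_; _:=_; con)

  summand-zeroˡ : ∀ i j a b e → qbinomial q a (+ i) ≈ 0# → summand i j a b e ≈ 0#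
  summand-zeroˡ i j a b e g≈0 = Z.trans
    (Z.*-congʳ {qbinomial (q ^ 3) b (+ j)} (Z.trans (Z.*-congˡ {(⊝ 1#) ^ j · q ^ e} g≈0) (Z.zeroʳ ((⊝ 1#) ^ j · q ^ e))))
    (Z.zeroˡ (qbinomial (q ^ 3) b (+ j)))

  summand-zeroʳ : ∀ i j a b e → qbinomial (q ^ 3) b (+ j) ≈ 0# → summand i j a b e ≈ 0#
  summand-zeroʳ i j a b e g≈0 =
    Z.trans (Z.*-congˡ {(⊝ 1#) ^ j · q ^ e · qbinomial q a (+ i)} g≈0) (Z.zeroʳ ((⊝ 1#) ^ j · q ^ e · qbinomial q a (+ i)))

  first-negative : ∀ n i j → n < μ i j → qbinomial q (+ n - + i - + (3 * j)) (+ i) ≈ 0#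
  first-negative n i j n<μ with μ i j ∸ n in eq | ℕ.m<n⇒0<n∸m n<μ
  ... | suc k | _ rewrite n-a-b≡-k {n} {i} {3 * j} {suc k}
        (≡.trans (≡.cong (λ k → n + k) (≡.sym eq)) (ℕ.m+[n∸m]≡n (ℕ.<⇒≤ n<μ))) = qbinomial-negative q k i

  summand-negative : ∀ n i j b e → n < μ i j → summand i j (+ n - + i - + (3 * j)) b e ≈ 0#
  summand-negative n i j b e n<μ = summand-zeroˡ i j (+ n - + i - + (3 * j)) b e (first-negative n i j n<μ)

  summand-product : ∀ i j N a b e → q ^ e ≈ w (μ i j) · q ^ tri i →
    qbinomial q a (+ i) ≈ gauss q N i → ∀ {v} → (⊝ 1#) ^ j · qbinomial (q ^ 3) b (+ j) ≈ v →
    summand i j a b e ≈ w (μ i j) · (u N i · v)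
  summand-product i j N a b e qᵉ≈ g≈ {v} h≈ = Z.trans
    (solve 4 (λ s p g h → s :* p :* g :* h := p :* (g :* (s :* h))) Z.refl
      ((⊝ 1#) ^ j) (q ^ e) (qbinomial q a (+ i)) (qbinomial (q ^ 3) b (+ j)))
    (Z.trans (Z.*-cong qᵉ≈ (Z.*-cong g≈ h≈))
      (solve 4 (λ w t g v → w :* t :* (g :* v) := w :* (t :* g :* v)) Z.refl (w (μ i j)) (q ^ tri i) (gauss q N i) v))

  -- The critical case is N = 0. For j = 0 the base q³ coefficient has upper index -1 and is 0 by
  -- convention, whereas `v 0 0` is 1; for i > 0 the factor `u 0 i` vanishes anyway, and i = 0 is
  -- excluded by the positivity premise.
  summand≈aTerm-at : ∀ i j N e → 0 < μ i j + N → q ^ e ≈ w (μ i j) · q ^ tri i →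
    summand i j (+ N) (+ (N + j) - + 1) e ≈ w (μ i j) · (u N i · v N j)
  summand≈aTerm-at zero    zero    zero    e ()  qᵉ≈
  summand≈aTerm-at (suc i) zero    zero    e 0<n qᵉ≈ = Z.trans
    (summand-zeroʳ (suc i) 0 (+ 0) (-[1+ 0 ]) e (qbinomial-negative (q ^ 3) 0 0))
    (solve 2 (λ a b → con 0 := a :* (b :* con 0 :* con 1)) Z.refl (w (μ (suc i) 0)) (q ^ tri (suc i)))
  summand≈aTerm-at i       (suc j) zero    e 0<n qᵉ≈ =
    summand-product i (suc j) 0 (+ 0) (+ j) e qᵉ≈ (qbinomial≈gauss q ≡.refl 0 i)
      (Z.trans (Z.*-congˡ {(⊝ 1#) ^ suc j} (Z.trans (qbinomial≈gauss (q ^ 3) ≡.refl j (suc j)) (gauss-zero (q ^ 3) (ℕ.n<1+n j))))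
        (Z.zeroʳ ((⊝ 1#) ^ suc j)))
  summand≈aTerm-at i       j       (suc N) e 0<n qᵉ≈ =
    summand-product i j (suc N) (+ suc N) (+ (N + j)) e qᵉ≈ (qbinomial≈gauss q ≡.refl (suc N) i)
      (Z.*-congˡ {(⊝ 1#) ^ j} (qbinomial≈gauss (q ^ 3) ≡.refl (N + j) j))

  summand≈aTerm : ∀ n i j e → 0 < n → q ^ e ≈ w (μ i j) · q ^ tri i →
    summand i j (+ n - + i - + (3 * j)) (+ n - + i - + (2 * j) - + 1) e ≈ aTerm n i j
  summand≈aTerm n i j e 0<n qᵉ≈ with ℕ.≤-<-connex (μ i j) n
  ... | inj₂ n<μ = Z.trans
        (summand-negative n i j (+ n - + i - + (2 * j) - + 1) e n<μ)
        (Z.sym (delay-zero (λ N → w (μ i j) · (u N i · v N j)) n<μ))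
  ... | inj₁ μ≤n = ≡.subst
        (λ n → 0 < n → summand i j (+ n - + i - + (3 * j)) (+ n - + i - + (2 * j) - + 1) e ≈ aTerm n i j)
        (ℕ.m+[n∸m]≡n μ≤n) (at (n ∸ μ i j)) 0<n
    where
    at : ∀ N → 0 < μ i j + N →
      summand i j (+ (μ i j + N) - + i - + (3 * j)) (+ (μ i j + N) - + i - + (2 * j) - + 1) e ≈ aTerm (μ i j + N) i j
    at N 0<n = ≡.subst₂ (λ a b → summand i j a b e ≈ aTerm (μ i j + N) i j)
      (≡.sym (+[a+b+k]-a-b i (3 * j) N))
      (≡.cong (_- + 1) (≡.sym (≡.trans (≡.cong (λ n → + n - + i - + (2 * j)) (i+3j+N i j N)) (+[a+b+k]-a-b i (2 * j) (N + j)))))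
      (Z.trans (summand≈aTerm-at i j N e 0<n qᵉ≈) (Z.sym (delay-at (μ i j) (λ N → w (μ i j) · (u N i · v N j)) N)))

-- Assembly of the two identities

x≈s+c⇒x⊖c≈s : ∀ {x s c} → x ≈ s ⊕ c → x ⊖ c ≈ s
x≈s+c⇒x⊖c≈s {x} {s} {c} x≈s+c = Z.trans (Z.+-congʳ {⊝ c} x≈s+c) (Z.trans (Z.+-assoc s c (⊝ c))
  (Z.trans (Z.+-congˡ {s} (Z.-‿inverseʳ c)) (Z.+-identityʳ s)))

1^n≈1 : ∀ n → 1# ^ n ≈ 1#
1^n≈1 zero    = Z.refl {1#}
1^n≈1 (suc n) = Z.trans (Z.*-identityˡ (1# ^ n)) (1^n≈1 n)

theorem1p4 : (n : ℕ) → 1 ≤ n → (m : ℕ) → n ≤ m →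
    ((∑[ i ≤ m ] ∑[ j ≤ m ]
    (⊝ 1#) ^ j · q ^ (i * i + 3 * i * j + 3 * j * (3 * j + 1) / 2)
    · qbinomial q (+ n - + i - + (3 * j)) (+ i)
    · qbinomial (q ^ 3) (+ n - + i - + (2 * j) - + 1) (+ j))
    ≈ (∑[ j ≤ m ]
    q ^ (j * (3 * j + 1)) · poch (q ^ 2) (q ^ 3) j
    · qbinomial q (+ n) (+ (3 * j + 1))))
    ×
    ((∑[ i ≤ m ] ∑[ j ≤ m ]
    (⊝ 1#) ^ j · q ^ (i * i + 3 * i * j + 3 * j * (3 * j + 1) / 2)
    · qbinomial q (+ n - + i - + (3 * j)) (+ i)
    · qbinomial (q ^ 3) (+ n - + i - + (2 * j) - + 1) (+ j))
    ⊖ q · (∑[ i ≤ m ] ∑[ j ≤ m ]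
    (⊝ 1#) ^ j · q ^ (i * (i + 1) + 3 * i * j + 9 * j * (j + 1) / 2)
    · qbinomial q (+ n - + i - + (3 * j) - + 1) (+ i)
    · qbinomial (q ^ 3) (+ n - + i - + (2 * j) - + 2) (+ j))
    ≈ (∑[ j ≤ m ]
    q ^ (j * (3 * j ∸ 1)) · poch q (q ^ 3) j
    · qbinomial q (+ n) (+ (3 * j))))
theorem1p4 (suc n) (s≤s z≤n) m n<m =
    Z.trans LHS≈A (Z.trans (first-identity m n n<m) (Z.sym RHS₁≈S₁))
  , Z.trans (x≈s+c⇒x⊖c≈s {LHS} {S₀ m (suc n)} {q · LHS′} (Z.trans LHS≈A (Z.trans (second-identity m n n<m)
      (Z.+-congˡ {S₀ m (suc n)} (Z.sym (qLHS′≈C n))))))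
      (Z.sym RHS₀≈S₀)
  where
  open DoubleSum using (A; aTerm; w≈; μ)
  open Terms

  e e′ : ℕ → ℕ → ℕ
  e i j = i * i + 3 * i * j + 3 * j * (3 * j + 1) / 2
  e′ i j = i * (i + 1) + 3 * i * j + 9 * j * (j + 1) / 2

  LHS-term LHS′-term : ℕ → ℕ → ℕ → Series
  LHS-term n i j = summand i j (+ n - + i - + (3 * j)) (+ n - + i - + (2 * j) - + 1) (e i j)
  LHS′-term n i j = summand i j (+ n - + i - + (3 * j) - + 1) (+ n - + i - + (2 * j) - + 2) (e′ i j)

  LHS LHS′ : Series
  LHS = ∑[ i ≤ m ] ∑[ j ≤ m ] LHS-term (suc n) i j
  LHS′ = ∑[ i ≤ m ] ∑[ j ≤ m ] LHS′-term (suc n) i j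

  ∑∑-cong : ∀ {f g : ℕ → ℕ → Series} → (∀ i j → f i j ≈ g i j) → (∑[ i ≤ m ] ∑[ j ≤ m ] f i j) ≈ (∑[ i ≤ m ] ∑[ j ≤ m ] g i j)
  ∑∑-cong f≈g = ∑<-cong (suc m) (λ i → ∑<-cong (suc m) (f≈g i))

  qᵉ : ∀ i j → q ^ e i j ≈ DoubleSum.w 1# m (μ 1# m i j) · q ^ tri i
  qᵉ i j = Z.trans (Exp.^-congʳ q (first-exponent i j)) (Z.trans (Exp.^-homo-* q (tri (suc M)) (tri i))
    (Z.*-congʳ {q ^ tri i} (Z.sym (Z.trans (w≈ 1# m M)
      (Z.trans (Z.*-congʳ {q ^ tri (suc M)} (1^n≈1 M)) (Z.*-identityˡ (q ^ tri (suc M))))))))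
    where
    M : ℕ
    M = i + 3 * j

  qᵉ′ : ∀ i j → q ^ e′ i j ≈ DoubleSum.w q m (μ q m i j) · q ^ tri i
  qᵉ′ i j = Z.trans (Exp.^-congʳ q (second-exponent i j)) (Z.trans (Exp.^-homo-* q (M + tri (suc M)) (tri i))
    (Z.*-congʳ {q ^ tri i} (Z.trans (Exp.^-homo-* q M (tri (suc M))) (Z.sym (w≈ q m M)))))
    where
    M : ℕ
    M = i + 3 * j

  LHS≈A : LHS ≈ A 1# m (suc n)
  LHS≈A = ∑∑-cong {LHS-term (suc n)} {aTerm 1# m (suc n)} (λ i j → summand≈aTerm 1# m (suc n) i j (e i j) (s≤s z≤n) (qᵉ i j))

  -- The extra -1 in both upper indices lowers n by one; only the exponent then distinguishes this
  -- summand from the first one.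
  LHS′-shift : ∀ n i j → LHS′-term (suc n) i j ≈ summand i j (+ n - + i - + (3 * j)) (+ n - + i - + (2 * j) - + 1) (e′ i j)
  LHS′-shift n i j k = ≡.cong₂ (λ a b → summand i j a b (e′ i j) k) ([1+n]-a-b-1 n i (3 * j)) ([1+n]-a-b-2 n i (2 * j))

  LHS′-term-1 : ∀ i j → LHS′-term 1 i j ≈ 0#
  -- For n = 1 the origin is the one term whose base q coefficient survives; the base q³
  -- coefficient, with upper index -1, removes it.
  LHS′-term-1 zero    zero    = Z.trans (LHS′-shift 0 0 0) (summand-zeroʳ q m 0 0 (+ 0) (-[1+ 0 ]) (e′ 0 0) (qbinomial-negative (q ^ 3) 0 0))
  LHS′-term-1 zero    (suc j) = Z.trans (LHS′-shift 0 0 (suc j))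
    (summand-negative q m 0 0 (suc j) (+ 0 - + 0 - + (2 * suc j) - + 1) (e′ 0 (suc j)) (s≤s z≤n))
  LHS′-term-1 (suc i) j       = Z.trans (LHS′-shift 0 (suc i) j)
    (summand-negative q m 0 (suc i) j (+ 0 - + suc i - + (2 * j) - + 1) (e′ (suc i) j) (s≤s z≤n))

  qLHS′≈C : ∀ n → q · (∑[ i ≤ m ] ∑[ j ≤ m ] LHS′-term (suc n) i j) ≈ C m n
  qLHS′≈C zero    = Z.trans
    (Z.*-congˡ {q} (∑<-zero (suc m) (λ i → ∑<-zero (suc m) (LHS′-term-1 i))))
    (Z.zeroʳ q)
  qLHS′≈C (suc n) = Z.*-congˡ {q} (∑∑-cong {LHS′-term (2 + n)} {aTerm q m (suc n)} (λ i j →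
    Z.trans (LHS′-shift (suc n) i j) (summand≈aTerm q m (suc n) i j (e′ i j) (s≤s z≤n) (qᵉ′ i j))))

  RHS₁≈S₁ : (∑[ j ≤ m ] d₁ j · qbinomial q (+ suc n) (+ (3 * j + 1))) ≈ S₁ m (suc n)
  RHS₁≈S₁ = ∑<-cong (suc m) (λ j → Z.*-congˡ {d₁ j} (qbinomial≈gauss q ≡.refl (suc n) (3 * j + 1)))

  RHS₀≈S₀ : (∑[ j ≤ m ] d₀ j · qbinomial q (+ suc n) (+ (3 * j))) ≈ S₀ m (suc n)
  RHS₀≈S₀ = ∑<-cong (suc m) (λ j → Z.*-congˡ {d₀ j} (qbinomial≈gauss q ≡.refl (suc n) (3 * j)))
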